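{- Let $h$ be either $\mathsf{MAJ}_3\colon\{0,1\}^3\to\{0,1\}$ or $\mathsf{AND}_2\circ\mathsf{OR}_2\colon\{0,1\}^4\to\{0,1\}$. There is a large enough constant $C>0$ such that for all Boolean functions $f$ and $g$, with $n$ the arity of the outer function in each composition below and $d\geq C\log\log n$, \[\widetilde{\deg}(f\circ h^d)=\Omega\left(\frac{\widetilde{\deg}(f)\,\widetilde{\deg}(h^d)}{\mathrm{polylog}(n)}\right)\quad\text{and}\quad \widetilde{\deg}(h^d\circ g)=\Omega\left(\frac{\widetilde{\deg}(h^d)\,\widetilde{\deg}(g)}{\mathrm{polylog}(n)}\right).\]
   Context: For Boolean $f\colon\{0,1\}^n\to\{0,1\}$, $g\colon\{0,1\}^m\to\{0,1\}$, the composition is $f\circ g(x_1,\dots,x_n)=f(g(x_1),\dots,g(x_n))$, $x_i\in\{0,1\}^m$. $h^d$ denotes $h$ composed with itself $d$ times. $\mathsf{MAJ}_3$ is the majority function on 3 bits; $\mathsf{AND}_2\circ\mathsf{OR}_2(x_1,x_2,x_3,x_4)=(x_1\vee x_2)\wedge(x_3\vee x_4)$. $\widetilde{\deg}(f)$ is the minimum degree of a real polynomial $p$ with $|p(x)-f(x)|\leq 1/3$ for all Boolean inputs $x$. $\mathrm{polylog}(n)$ denotes a factor $(\log n)^{O(1)}$.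
   Formalization: The approximating polynomials in the definition of approximate degree have rational instead of real coefficients; the degree is the same, since a system of linear inequalities with rational data that has a real solution has a rational one. -}

module Defs where

open import Data.Bool using (Bool; true; false; _∧_; _∨_; if_then_else_)
open import Data.Nat as ℕ using (ℕ; zero; suc; _^_)
open import Data.Fin using (Fin; zero; suc; combine)
open import Data.Product using (_×_; _,_; ∃; ∃-syntax)
open import Data.List using (List; []; _∷_)
open import Data.List.Relation.Unary.All using (All)
open import Data.Integer using (+_)
open import Data.Rational as ℚ using (ℚ; 0ℚ; 1ℚ; ∣_∣)

BoolFn : ℕ → Set
BoolFn n = (Fin n → Bool) → Bool

_⊚_ : ∀ {n m} → BoolFn n → BoolFn m → BoolFn (n ℕ.* m)
(f ⊚ g) x = f (λ i → g (λ j → x (combine i j)))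

_^^_ : ∀ {k} → BoolFn k → (d : ℕ) → BoolFn (k ^ d)
(h ^^ zero) x = x zero
(h ^^ suc d) = h ⊚ (h ^^ d)

MAJ₃ : BoolFn 3
MAJ₃ x = (x zero ∧ x (suc zero)) ∨ (x zero ∧ x (suc (suc zero))) ∨ (x (suc zero) ∧ x (suc (suc zero)))

AND₂∘OR₂ : BoolFn 4
AND₂∘OR₂ x = (x zero ∨ x (suc zero)) ∧ (x (suc (suc zero)) ∨ x (suc (suc (suc zero))))

χ : Bool → ℚ
χ true = 1ℚ
χ false = 0ℚ

size : ∀ {n} → (Fin n → Bool) → ℕ
size {zero} S = 0
size {suc n} S = (if S zero then 1 else 0) ℕ.+ size (λ i → S (suc i))

monoEval : ∀ {n} → (Fin n → Bool) → (Fin n → Bool) → ℚ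
monoEval {zero} S x = 1ℚ
monoEval {suc n} S x =
  (if S zero then χ (x zero) else 1ℚ) ℚ.* monoEval (λ i → S (suc i)) (λ i → x (suc i))

-- A (multilinear) real-coefficient polynomial in n variables, as a finite list of
-- terms (coefficient, monomial).  Coefficients are rational.
Poly : ℕ → Set
Poly n = List (ℚ × (Fin n → Bool))

eval : ∀ {n} → Poly n → (Fin n → Bool) → ℚ
eval [] x = 0ℚ
eval ((c , S) ∷ p) x = c ℚ.* monoEval S x ℚ.+ eval p x

DegreeAtMost : ∀ {n} → ℕ → Poly n → Set
DegreeAtMost k p = All (λ t → size (Data.Product.proj₂ t) ℕ.≤ k) p

Approximates : ∀ {n} → Poly n → BoolFn n → Set
Approximates p f = ∀ x → ∣ eval p x ℚ.- χ (f x) ∣ ℚ.≤ (+ 1 ℚ./ 3)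

ApproxDegAtMost : ∀ {n} → BoolFn n → ℕ → Set
ApproxDegAtMost f k = ∃[ p ] (DegreeAtMost k p × Approximates p f)

IsApproxDeg : ∀ {n} → BoolFn n → ℕ → Set
IsApproxDeg f k = ApproxDegAtMost f k × (∀ k′ → ApproxDegAtMost f k′ → k ℕ.≤ k′)

data Base : Set where
  maj₃ andOr : Base

arity : Base → ℕ
arity maj₃ = 3
arity andOr = 4

fn : (b : Base) → BoolFn (arity b)
fn maj₃ = MAJ₃
fn andOr = AND₂∘OR₂

{-# OPTIONS --safe #-}

-- If no polynomial of degree less than w approximates g, then by linear programming duality there are
-- distributions μ₀ and μ₁ on the inputs of g which no polynomial of degree less than w tells apart, such that
-- g = v with probability at least 2/3 under μᵥ. Evaluating h on independent samples of μᵥ preserves the first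
-- property and, since 1/3 is below the repelling fixed point of the bias map of h, improves the second:
-- after j + O(1) levels of h the error is at most 2^(-2^j), so that O(log log n) levels bring it below 1/(4n).
-- The average of an approximant of f ∘ h^j ∘ g over the resulting product distributions, with the
-- distribution in block i chosen by zᵢ, is then a polynomial in z which approximates f, and its degree has
-- dropped by a factor w. The levels spent in the middle change approximate degrees by a polylogarithmic
-- factor only, because adeg(h ∘ G) = O(adeg(G)) and adeg(F ∘ h^j) ≤ arity(h)^j adeg(F). If h^d is too shallow for
-- this, it has only polylogarithmically many variables, and the bounds are trivial.

module Submission where

-- Rational inequalities, errors of values in [0,1], and the bias maps of the two base functions.

module Rationals where

  open import Defs using (χ)
  open import Data.Bool using (Bool; true; false; T)
  open import Data.Integer using (+_)
  open import Data.Product using (_×_; _,_; proj₁)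
  open import Data.Rational
  open import Data.Rational.Properties
  open import Data.Sum using (inj₁; inj₂)
  open import Relation.Binary.PropositionalEquality
  open import Relation.Nullary.Decidable using (dec⇒maybe)
  open import Tactic.RingSolver using (solve-∀)
  open import Tactic.RingSolver.Core.AlmostCommutativeRing using (AlmostCommutativeRing; fromCommutativeRing)

  ℚ-ring : AlmostCommutativeRing _ _
  ℚ-ring = fromCommutativeRing +-*-commutativeRing λ x → dec⇒maybe (0ℚ ≟ x)

  2ℚ 3ℚ : ℚ
  2ℚ = + 2 / 1
  3ℚ = + 3 / 1

  ≤-diff : ∀ {a b} d → b ≡ a + d → 0ℚ ≤ d → a ≤ b
  ≤-diff {a} d refl 0≤d = subst (_≤ a + d) (+-identityʳ a) (+-monoʳ-≤ a 0≤d)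

  0≤diff : ∀ {a b} → a ≤ b → 0ℚ ≤ b - a
  0≤diff {a} {b} a≤b = subst (_≤ b - a) (+-inverseʳ a) (+-monoˡ-≤ (- a) a≤b)

  diff≤ : ∀ {a b} → 0ℚ ≤ b - a → a ≤ b
  diff≤ {a} {b} = ≤-diff (b - a) (lemma a b)
    where
    lemma : ∀ a b → b ≡ a + (b - a)
    lemma = solve-∀ ℚ-ring

  +-nonneg : ∀ {a b} → 0ℚ ≤ a → 0ℚ ≤ b → 0ℚ ≤ a + b
  +-nonneg = +-mono-≤

  *-monoˡ : ∀ {a b c} → 0ℚ ≤ c → a ≤ b → c * a ≤ c * b
  *-monoˡ {c = c} 0≤c = *-monoˡ-≤-nonNeg c {{nonNegative 0≤c}}

  *-monoʳ : ∀ {a b c} → 0ℚ ≤ c → a ≤ b → a * c ≤ b * c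
  *-monoʳ {c = c} 0≤c = *-monoʳ-≤-nonNeg c {{nonNegative 0≤c}}

  *-nonneg : ∀ {a b} → 0ℚ ≤ a → 0ℚ ≤ b → 0ℚ ≤ a * b
  *-nonneg {a} {b} 0≤a 0≤b = subst (_≤ a * b) (*-zeroʳ a) (*-monoˡ 0≤a 0≤b)

  InUnit : ℚ → Set
  InUnit y = 0ℚ ≤ y × y ≤ 1ℚ

  -- For `y` in [0,1] this is the distance of `y` from the bit. Written without an absolute value it
  -- is affine in `y` and commutes with averages.
  err : Bool → ℚ → ℚ
  err false y = y
  err true  y = 1ℚ - y

  err-unit : ∀ b {y} → InUnit y → InUnit (err b y)
  err-unit false u = u
  err-unit true {y} (0≤y , y≤1) = 0≤diff y≤1 , ≤-diff y (lemma y) 0≤y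
    where
    lemma : ∀ y → 1ℚ ≡ 1ℚ - y + y
    lemma = solve-∀ ℚ-ring

  χ-unit : ∀ b → InUnit (χ b)
  χ-unit true  = ≤ᵇ⇒≤ _ , ≤-refl
  χ-unit false = ≤-refl , ≤ᵇ⇒≤ _

  err-χ : ∀ b → err b (χ b) ≡ 0ℚ
  err-χ true  = refl
  err-χ false = refl

  -- Membership in [0,1], where the majority map is monotone, travels with the error bound.
  record Close (c : ℚ) (b : Bool) (y : ℚ) : Set where
    constructor close
    field
      unit  : InUnit y
      bound : err b y ≤ c

  open Close public

  close-weaken : ∀ {c d b y} → c ≤ d → Close c b y → Close d b y
  close-weaken c≤d (close u e) = close u (≤-trans e c≤d)

  close⇒near : ∀ {c b y} → 0ℚ ≤ c → Close c b y → ∣ y - χ b ∣ ≤ c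
  close⇒near {c} {false} {y} _ (close (0≤y , _) e) =
    subst (_≤ c) (sym (trans (cong ∣_∣ (+-identityʳ y)) (0≤p⇒∣p∣≡p 0≤y))) e
  close⇒near {c} {true} {y} _ (close (_ , y≤1) e) =
    subst (_≤ c) (trans (sym (0≤p⇒∣p∣≡p (0≤diff y≤1))) (trans (sym (∣-p∣≡∣p∣ (1ℚ - y))) (cong ∣_∣ (lemma y)))) e
    where
    lemma : ∀ y → - (1ℚ - y) ≡ y - 1ℚ
    lemma = solve-∀ ℚ-ring

  p≤∣p∣ : ∀ p → p ≤ ∣ p ∣
  p≤∣p∣ p with ≤-total 0ℚ p
  ... | inj₁ 0≤p = ≤-reflexive (sym (0≤p⇒∣p∣≡p 0≤p))
  ... | inj₂ p≤0 = ≤-trans p≤0 (0≤∣p∣ p)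

  ∣∣≤⇒bounds : ∀ {p c} → ∣ p ∣ ≤ c → p ≤ c × - p ≤ c
  ∣∣≤⇒bounds {p} {c} h = ≤-trans (p≤∣p∣ p) h , ≤-trans (p≤∣p∣ (- p)) (subst (_≤ c) (sym (∣-p∣≡∣p∣ p)) h)

  bounds⇒∣∣≤ : ∀ {p c} → p ≤ c → - p ≤ c → ∣ p ∣ ≤ c
  bounds⇒∣∣≤ {p} {c} p≤c -p≤c with ∣p∣≡p∨∣p∣≡-p p
  ... | inj₁ eq = subst (_≤ c) (sym eq) p≤c
  ... | inj₂ eq = subst (_≤ c) (sym eq) -p≤c

  -- The probability that the majority of three independent bits of bias y is 1.
  majBias : ℚ → ℚ
  majBias y = y * y * (3ℚ - 2ℚ * y)

  -- The difference of the two sides is `c - y` times a sum of terms that are nonnegative on [0,1].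
  maj-mono : ∀ {y c} → 0ℚ ≤ y → c ≤ 1ℚ → y ≤ c → majBias y ≤ majBias c
  maj-mono {y} {c} 0≤y c≤1 y≤c = diff≤ (subst (0ℚ ≤_) (sym (lemma c y))
    (*-nonneg (0≤diff y≤c) (+-nonneg (+-nonneg (+-nonneg
      (*-nonneg 0≤2 (*-nonneg 0≤c (0≤diff c≤1)))
      (*-nonneg 0≤2 (*-nonneg 0≤y (0≤diff y≤1))))
      (*-nonneg 0≤c (0≤diff y≤1)))
      (*-nonneg 0≤y (0≤diff c≤1)))))
    where
    0≤2 : 0ℚ ≤ 2ℚ
    0≤2 = ≤ᵇ⇒≤ _
    0≤c : 0ℚ ≤ c
    0≤c = ≤-trans 0≤y y≤c
    y≤1 : y ≤ 1ℚ
    y≤1 = ≤-trans y≤c c≤1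
    lemma : ∀ c y → c * c * ((+ 3 / 1) - (+ 2 / 1) * c) - y * y * ((+ 3 / 1) - (+ 2 / 1) * y)
      ≡ (c - y) * ((+ 2 / 1) * (c * (1ℚ - c)) + (+ 2 / 1) * (y * (1ℚ - y)) + c * (1ℚ - y) + y * (1ℚ - c))
    lemma = solve-∀ ℚ-ring

  maj-unit : ∀ {y} → InUnit y → InUnit (majBias y)
  maj-unit (0≤y , y≤1) = maj-mono ≤-refl y≤1 0≤y , maj-mono 0≤y ≤-refl y≤1

  -- Majority is self-dual, so the errors for the bits 0 and 1 evolve by the same map.
  err-maj : ∀ b y → err b (majBias y) ≡ majBias (err b y)
  err-maj false y = refl
  err-maj true  y = lemma y
    where
    lemma : ∀ y → 1ℚ - y * y * ((+ 3 / 1) - (+ 2 / 1) * y) ≡ (1ℚ - y) * (1ℚ - y) * ((+ 3 / 1) - (+ 2 / 1) * (1ℚ - y))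
    lemma = solve-∀ ℚ-ring

  close-maj : ∀ {c b y} → c ≤ 1ℚ → Close c b y → Close (majBias c) b (majBias y)
  close-maj {c} {b} {y} c≤1 (close u e) =
    close (maj-unit u) (subst (_≤ majBias c) (sym (err-maj b y)) (maj-mono (proj₁ (err-unit b u)) c≤1 e))

  -- The affine map of [-1/3, 4/3] onto [0,1].
  squeeze : ℚ → ℚ
  squeeze y = (+ 3 / 5) * y + (+ 1 / 5)

  close-squeeze : ∀ {b} y → ∣ y - χ b ∣ ≤ + 1 / 3 → Close (+ 2 / 5) b (squeeze y)
  close-squeeze {b} y h with ∣∣≤⇒bounds {y - χ b} h
  close-squeeze {false} y h | u , l =
    close (lo , ≤-trans hi (≤ᵇ⇒≤ _)) hi
    where
    e₁ : ∀ y → (+ 3 / 5) * y + (+ 1 / 5) - 0ℚ ≡ (+ 3 / 5) * (+ 1 / 3 - (- (y - 0ℚ)))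
    e₁ = solve-∀ ℚ-ring
    e₂ : ∀ y → + 2 / 5 - ((+ 3 / 5) * y + (+ 1 / 5)) ≡ (+ 3 / 5) * (+ 1 / 3 - (y - 0ℚ))
    e₂ = solve-∀ ℚ-ring
    lo : 0ℚ ≤ squeeze y
    lo = diff≤ (subst (0ℚ ≤_) (sym (e₁ y)) (*-nonneg {+ 3 / 5} (≤ᵇ⇒≤ _) (0≤diff l)))
    hi : squeeze y ≤ + 2 / 5
    hi = diff≤ (subst (0ℚ ≤_) (sym (e₂ y)) (*-nonneg {+ 3 / 5} (≤ᵇ⇒≤ _) (0≤diff u)))
  close-squeeze {true} y h | u , l =
    close (≤-trans {j = + 3 / 5} (≤ᵇ⇒≤ _) lo , hi) (diff≤ (subst (0ℚ ≤_) (e₃ (squeeze y)) (0≤diff lo)))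
    where
    e₁ : ∀ y → (+ 3 / 5) * y + (+ 1 / 5) - + 3 / 5 ≡ (+ 3 / 5) * (+ 1 / 3 - (- (y - 1ℚ)))
    e₁ = solve-∀ ℚ-ring
    e₂ : ∀ y → 1ℚ - ((+ 3 / 5) * y + (+ 1 / 5)) ≡ (+ 3 / 5) * (+ 1 / 3 - (y - 1ℚ))
    e₂ = solve-∀ ℚ-ring
    e₃ : ∀ z → z - + 3 / 5 ≡ + 2 / 5 - (1ℚ - z)
    e₃ = solve-∀ ℚ-ring
    lo : + 3 / 5 ≤ squeeze y
    lo = diff≤ (subst (0ℚ ≤_) (sym (e₁ y)) (*-nonneg {+ 3 / 5} (≤ᵇ⇒≤ _) (0≤diff l)))
    hi : squeeze y ≤ 1ℚ
    hi = diff≤ (subst (0ℚ ≤_) (sym (e₂ y)) (*-nonneg {+ 3 / 5} (≤ᵇ⇒≤ _) (0≤diff u)))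

  -- The error falls as 1/3 → 2/5 → 9/25 → 3/10 → 11/50 → 1/8 → 1/12; squeezing into [0,1] costs the first step.
  boost : ℚ → ℚ
  boost y = majBias (majBias (majBias (majBias (majBias (squeeze y)))))

  close-boost : ∀ {b} y → ∣ y - χ b ∣ ≤ + 1 / 3 → Close (+ 1 / 12) b (boost y)
  close-boost y h =
    step (+ 1 / 8) (+ 1 / 12) y₄ _ _ (step (+ 11 / 50) (+ 1 / 8) y₃ _ _ (step (+ 3 / 10) (+ 11 / 50) y₂ _ _
      (step (+ 9 / 25) (+ 3 / 10) y₁ _ _ (step (+ 2 / 5) (+ 9 / 25) y₀ _ _ (close-squeeze y h)))))
    where
    step : ∀ c d {b} y → T (c ≤ᵇ 1ℚ) → T (majBias c ≤ᵇ d) → Close c b y → Close d b (majBias y)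
    step c d y c≤1 e k = close-weaken (≤ᵇ⇒≤ e) (close-maj (≤ᵇ⇒≤ c≤1) k)
    y₀ = squeeze y
    y₁ = majBias y₀
    y₂ = majBias y₁
    y₃ = majBias y₂
    y₄ = majBias y₃

  -- The probability that (x₁ ∨ x₂) ∧ (x₃ ∨ x₄) is 1 on independent bits of bias c.
  andOrBias : ℚ → ℚ
  andOrBias c = c * (2ℚ - c) * (c * (2ℚ - c))

  andOr-mono : ∀ {y c} → 0ℚ ≤ y → c ≤ 1ℚ → y ≤ c → andOrBias y ≤ andOrBias c
  andOr-mono {y} {c} 0≤y c≤1 y≤c = ≤-trans (*-monoʳ 0≤ty ty≤tc) (*-monoˡ (≤-trans 0≤ty ty≤tc) ty≤tc)
    where
    y≤1 : y ≤ 1ℚ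
    y≤1 = ≤-trans y≤c c≤1
    e₀ : ∀ y → y * ((+ 2 / 1) - y) ≡ y * (1ℚ + (1ℚ - y))
    e₀ = solve-∀ ℚ-ring
    0≤ty : 0ℚ ≤ y * (2ℚ - y)
    0≤ty = subst (0ℚ ≤_) (sym (e₀ y)) (*-nonneg 0≤y (+-nonneg {1ℚ} (≤ᵇ⇒≤ _) (0≤diff y≤1)))
    e₁ : ∀ c y → c * ((+ 2 / 1) - c) - y * ((+ 2 / 1) - y) ≡ (c - y) * ((1ℚ - c) + (1ℚ - y))
    e₁ = solve-∀ ℚ-ring
    ty≤tc : y * (2ℚ - y) ≤ c * (2ℚ - c)
    ty≤tc = diff≤ (subst (0ℚ ≤_) (sym (e₁ c y)) (*-nonneg (0≤diff y≤c) (+-nonneg (0≤diff c≤1) (0≤diff y≤1))))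

  sq-nonneg : ∀ a → 0ℚ ≤ a * a
  sq-nonneg a with ≤-total 0ℚ a
  ... | inj₁ 0≤a = *-nonneg 0≤a 0≤a
  ... | inj₂ a≤0 = subst (0ℚ ≤_) (lemma a) (*-nonneg (0≤diff a≤0) (0≤diff a≤0))
    where
    lemma : ∀ a → (0ℚ - a) * (0ℚ - a) ≡ a * a
    lemma = solve-∀ ℚ-ring

  -- The difference is a square. Hence `andOrBias` bounds the error growth of both base functions,
  -- and a single recursion serves for the two.
  maj≤andOr : ∀ y → majBias y ≤ andOrBias y
  maj≤andOr y = diff≤ (subst (0ℚ ≤_) (sym (lemma y)) (sq-nonneg (y * (1ℚ - y))))
    where
    lemma : ∀ y → y * ((+ 2 / 1) - y) * (y * ((+ 2 / 1) - y)) - y * y * ((+ 3 / 1) - (+ 2 / 1) * y) ≡ y * (1ℚ - y) * (y * (1ℚ - y))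
    lemma = solve-∀ ℚ-ring

  -- AND-OR is not self-dual. For the bit 1 an error e becomes 2e² - e⁴, which is at most the value
  -- e²(2 - e)² for the bit 0, because the difference is twice a square.
  err-andOr : ∀ b y → err b (andOrBias y) ≤ andOrBias (err b y)
  err-andOr false y = ≤-refl
  err-andOr true  y = diff≤ (subst (0ℚ ≤_) (sym (lemma y))
    (*-nonneg {2ℚ} (≤ᵇ⇒≤ _) (sq-nonneg (y * (1ℚ - y)))))
    where
    lemma : ∀ y → (1ℚ - y) * ((+ 2 / 1) - (1ℚ - y)) * ((1ℚ - y) * ((+ 2 / 1) - (1ℚ - y))) - (1ℚ - y * ((+ 2 / 1) - y) * (y * ((+ 2 / 1) - y)))
      ≡ (+ 2 / 1) * (y * (1ℚ - y) * (y * (1ℚ - y)))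
    lemma = solve-∀ ℚ-ring

  -- Below 1/4 the squaring outweighs the factor 4; this is the source of the doubly exponential
  -- decay.
  andOr≤4sq : ∀ {c} → InUnit c → andOrBias c ≤ (+ 4 / 1) * (c * c)
  andOr≤4sq {c} (0≤c , c≤1) = diff≤ (subst (0ℚ ≤_) (sym (lemma c))
    (*-nonneg (*-nonneg 0≤c 0≤c) (*-nonneg 0≤c (+-nonneg {3ℚ} (≤ᵇ⇒≤ _) (0≤diff c≤1)))))
    where
    lemma : ∀ c → (+ 4 / 1) * (c * c) - c * ((+ 2 / 1) - c) * (c * ((+ 2 / 1) - c)) ≡ c * c * (c * ((+ 3 / 1) + (1ℚ - c)))
    lemma = solve-∀ ℚ-ring

-- Degree of functions on the Boolean cube.

module Degree where

  open import Defs
  open import Data.Bool using (Bool; true; false; _∨_; if_then_else_)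
  open import Data.Fin using (Fin; zero; suc; combine; _↑ˡ_; _↑ʳ_)
  open import Data.List using ([]; _∷_; map; _++_)
  open import Data.List.Relation.Unary.All as All using ([]; _∷_)
  import Data.List.Relation.Unary.All.Properties as All
  open import Data.Nat as ℕ using (ℕ; zero; suc; z≤n; s≤s)
  import Data.Nat.Properties as ℕ
  open import Data.Product using (_×_; _,_; ∃)
  open import Data.Rational
  open import Data.Rational.Properties
  open import Function using (_∘_)
  open import Relation.Binary.PropositionalEquality
  open import Tactic.RingSolver using (solve-∀)
  import Algebra.Definitions.RawMonoid as RawMonoid
  open Rationals using (ℚ-ring)

  open RawMonoid *-1-rawMonoid renaming (sum to ∏) using () public
  open RawMonoid ℕ.+-0-rawMonoid using (sum) public

  -- Inputs are functions and function extensionality is not assumed, so respect for pointwise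
  -- equality is tracked explicitly.
  Extensional : ∀ {n} {A : Set} → ((Fin n → Bool) → A) → Set
  Extensional φ = ∀ {x y} → x ≗ y → φ x ≡ φ y

  factor : Bool → Bool → ℚ
  factor s u = if s then χ u else 1ℚ

  monoEval-cong : ∀ {n} {S T x y : Fin n → Bool} → S ≗ T → x ≗ y → monoEval S x ≡ monoEval T y
  monoEval-cong {zero}  _ _ = refl
  monoEval-cong {suc n} p q = cong₂ _*_ (cong₂ factor (p zero) (q zero)) (monoEval-cong (p ∘ suc) (q ∘ suc))

  size-cong : ∀ {n} {S T : Fin n → Bool} → S ≗ T → size S ≡ size T
  size-cong {zero}  p = refl
  size-cong {suc n} p = cong₂ ℕ._+_ (cong (λ s → if s then 1 else 0) (p zero)) (size-cong (p ∘ suc))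

  eval-cong : ∀ {n} (p : Poly n) → Extensional (eval p)
  eval-cong []            e = refl
  eval-cong ((c , S) ∷ p) e = cong₂ _+_ (cong (c *_) (monoEval-cong {S = S} (λ _ → refl) e)) (eval-cong p e)

  eval-++ : ∀ {n} (p q : Poly n) x → eval (p ++ q) x ≡ eval p x + eval q x
  eval-++ []            q x = sym (+-identityˡ (eval q x))
  eval-++ ((c , S) ∷ p) q x = trans (cong (c * monoEval S x +_) (eval-++ p q x)) (sym (+-assoc (c * monoEval S x) (eval p x) (eval q x)))

  monoEval-∅ : ∀ {n} (x : Fin n → Bool) → monoEval (λ _ → false) x ≡ 1ℚ
  monoEval-∅ {zero}  x = refl
  monoEval-∅ {suc n} x = trans (*-identityˡ _) (monoEval-∅ (x ∘ suc))

  size-∅ : ∀ n → size {n} (λ _ → false) ≡ 0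
  size-∅ zero    = refl
  size-∅ (suc n) = size-∅ n

  -- On bits x² = x, so a product of monomials is again a multilinear monomial.
  monoEval-∪ : ∀ {n} (S T x : Fin n → Bool) → monoEval (λ i → S i ∨ T i) x ≡ monoEval S x * monoEval T x
  monoEval-∪ {zero}  S T x = refl
  monoEval-∪ {suc n} S T x = trans
    (cong₂ _*_ (factor-∨ (S zero) (T zero) (x zero)) (monoEval-∪ (S ∘ suc) (T ∘ suc) (x ∘ suc)))
    (interchange (factor (S zero) (x zero)) _ (monoEval (S ∘ suc) (x ∘ suc)) _)
    where
    interchange : ∀ a b c d → a * b * (c * d) ≡ a * c * (b * d)
    interchange = solve-∀ ℚ-ring
    factor-∨ : ∀ s t u → factor (s ∨ t) u ≡ factor s u * factor t u
    factor-∨ true  true  true  = refl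
    factor-∨ true  true  false = refl
    factor-∨ true  false true  = refl
    factor-∨ true  false false = refl
    factor-∨ false true  true  = refl
    factor-∨ false true  false = refl
    factor-∨ false false u     = refl

  size-∪ : ∀ {n} (S T : Fin n → Bool) → size (λ i → S i ∨ T i) ℕ.≤ size S ℕ.+ size T
  size-∪ {zero}  S T = z≤n
  size-∪ {suc n} S T with S zero | T zero | size-∪ (S ∘ suc) (T ∘ suc)
  ... | true  | true  | ih = s≤s (ℕ.≤-trans (ℕ.m≤n⇒m≤1+n ih) (ℕ.≤-reflexive (sym (ℕ.+-suc _ _))))
  ... | true  | false | ih = s≤s ih
  ... | false | true  | ih = ℕ.≤-trans (s≤s ih) (ℕ.≤-reflexive (sym (ℕ.+-suc _ _)))
  ... | false | false | ih = ih

  monoEval-↑ : ∀ m {n} (S x : Fin (m ℕ.+ n) → Bool) →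
    monoEval S x ≡ monoEval (S ∘ (_↑ˡ n)) (x ∘ (_↑ˡ n)) * monoEval (S ∘ (m ↑ʳ_)) (x ∘ (m ↑ʳ_))
  monoEval-↑ zero    S x = sym (*-identityˡ _)
  monoEval-↑ (suc m) S x = trans (cong (factor (S zero) (x zero) *_) (monoEval-↑ m (S ∘ suc) (x ∘ suc)))
    (sym (*-assoc (factor (S zero) (x zero)) _ _))

  size-↑ : ∀ m {n} (S : Fin (m ℕ.+ n) → Bool) → size S ≡ size (S ∘ (_↑ˡ n)) ℕ.+ size (S ∘ (m ↑ʳ_))
  size-↑ zero    S = refl
  size-↑ (suc m) S = trans (cong ((if S zero then 1 else 0) ℕ.+_) (size-↑ m (S ∘ suc)))
    (sym (ℕ.+-assoc (if S zero then 1 else 0) _ _))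

  monoEval-combine : ∀ n {m} (S x : Fin (n ℕ.* m) → Bool) →
    monoEval S x ≡ ∏ (λ i → monoEval (S ∘ combine {n} i) (x ∘ combine {n} i))
  monoEval-combine zero        S x = refl
  monoEval-combine (suc n) {m} S x =
    trans (monoEval-↑ m S x) (cong (monoEval (S ∘ (_↑ˡ (n ℕ.* m))) (x ∘ (_↑ˡ (n ℕ.* m))) *_) (monoEval-combine n (S ∘ (m ↑ʳ_)) (x ∘ (m ↑ʳ_))))

  size-combine : ∀ n {m} (S : Fin (n ℕ.* m) → Bool) → size S ≡ sum (λ i → size (S ∘ combine {n} i))
  size-combine zero        S = refl
  size-combine (suc n) {m} S = trans (size-↑ m S) (cong (size (S ∘ (_↑ˡ (n ℕ.* m))) ℕ.+_) (size-combine n (S ∘ (m ↑ʳ_))))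

  ∏-cong : ∀ {n} {φ ψ : Fin n → ℚ} → φ ≗ ψ → ∏ φ ≡ ∏ ψ
  ∏-cong {zero}  e = refl
  ∏-cong {suc n} e = cong₂ _*_ (e zero) (∏-cong (e ∘ suc))

  -- Functionals are given by their action instead of by weights: evaluation at a point, evaluation
  -- after multiplication by a fixed function, and expectations are then instances of one notion.
  record Linear (X : Set) : Set where
    field
      ap      : (X → ℚ) → ℚ
      ap-cong : ∀ {φ ψ} → φ ≗ ψ → ap φ ≡ ap ψ
      ap-+    : ∀ φ ψ → ap (λ x → φ x + ψ x) ≡ ap φ + ap ψ
      ap-*    : ∀ c φ → ap (λ x → c * φ x) ≡ c * ap φ

    ap-0 : ap (λ _ → 0ℚ) ≡ 0ℚ
    ap-0 = trans (ap-cong (λ _ → sym (*-zeroˡ 0ℚ))) (trans (ap-* 0ℚ (λ _ → 0ℚ)) (*-zeroˡ (ap (λ _ → 0ℚ))))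

  -- Degree is a property of the function on the cube, so identities between polynomials have to
  -- hold at Boolean points only.
  HasDeg : ∀ {n} → ℕ → ((Fin n → Bool) → ℚ) → Set
  HasDeg {n} D φ = ∃ λ (p : Poly n) → DegreeAtMost D p × (∀ x → eval p x ≡ φ x)

  deg-cong : ∀ {n D} {φ ψ : (Fin n → Bool) → ℚ} → φ ≗ ψ → HasDeg D φ → HasDeg D ψ
  deg-cong e (p , d , v) = p , d , λ x → trans (v x) (e x)

  deg-weaken : ∀ {n D E} {φ : (Fin n → Bool) → ℚ} → D ℕ.≤ E → HasDeg D φ → HasDeg E φ
  deg-weaken D≤E (p , d , v) = p , All.map (λ s → ℕ.≤-trans s D≤E) d , v

  deg-mono : ∀ {n} (S : Fin n → Bool) → HasDeg (size S) (monoEval S)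
  deg-mono S = (1ℚ , S) ∷ [] , ℕ.≤-refl ∷ [] , λ x → lemma (monoEval S x)
    where
    lemma : ∀ a → 1ℚ * a + 0ℚ ≡ a
    lemma = solve-∀ ℚ-ring

  deg-+ : ∀ {n D} {φ ψ : (Fin n → Bool) → ℚ} → HasDeg D φ → HasDeg D ψ → HasDeg D (λ x → φ x + ψ x)
  deg-+ (p , d , v) (q , e , w) = p ++ q , All.++⁺ d e , λ x → trans (eval-++ p q x) (cong₂ _+_ (v x) (w x))

  deg-scale : ∀ {n D} c {φ : (Fin n → Bool) → ℚ} → HasDeg D φ → HasDeg D (λ x → c * φ x)
  deg-scale {n} c (p , d , v) = map scale p , All.map⁺ d , λ x → trans (eval-scale p x) (cong (c *_) (v x))
    where
    scale : ℚ × (Fin n → Bool) → ℚ × (Fin n → Bool)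
    scale (a , S) = c * a , S
    lemma : ∀ c a u v → c * a * u + c * v ≡ c * (a * u + v)
    lemma = solve-∀ ℚ-ring
    eval-scale : ∀ p x → eval (map scale p) x ≡ c * eval p x
    eval-scale []            x = sym (*-zeroʳ c)
    eval-scale ((a , S) ∷ p) x = trans (cong (c * a * monoEval S x +_) (eval-scale p x)) (lemma c a (monoEval S x) (eval p x))

  deg-const : ∀ {n} c → HasDeg {n} 0 (λ _ → c)
  deg-const {n} c = (c , λ _ → false) ∷ [] , ℕ.≤-reflexive (size-∅ n) ∷ [] ,
    λ x → trans (cong (λ v → c * v + 0ℚ) (monoEval-∅ x)) (lemma c)
    where
    lemma : ∀ c → c * 1ℚ + 0ℚ ≡ c
    lemma = solve-∀ ℚ-ring

  -- By linearity it suffices to treat monomials. Products, substitution and averaging over a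
  -- distribution that depends on `z` are all obtained this way.
  deg-linear : ∀ {n k D E} (L : (Fin k → Bool) → Linear (Fin n → Bool)) →
    (∀ S → size S ℕ.≤ D → HasDeg E (λ z → Linear.ap (L z) (monoEval S))) →
    ∀ {φ} → HasDeg D φ → HasDeg E (λ z → Linear.ap (L z) φ)
  deg-linear {D = D} {E} L mono (p , d , v) = deg-cong (λ z → Linear.ap-cong (L z) v) (go p d)
    where
    go : ∀ p → DegreeAtMost D p → HasDeg E (λ z → Linear.ap (L z) (eval p))
    go []            []      = deg-cong (λ z → sym (Linear.ap-0 (L z))) (deg-weaken z≤n (deg-const 0ℚ))
    go ((c , S) ∷ p) (s ∷ d) = deg-cong
      (λ z → sym (trans (Linear.ap-+ (L z) (λ x → c * monoEval S x) (eval p))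
                        (cong (_+ _) (Linear.ap-* (L z) c (monoEval S)))))
      (deg-+ (deg-scale c (mono S s)) (go p d))

  times : ∀ {n} → ((Fin n → Bool) → ℚ) → (Fin n → Bool) → Linear (Fin n → Bool)
  times ψ x = record
    { ap      = λ φ → ψ x * φ x
    ; ap-cong = λ e → cong (ψ x *_) (e x)
    ; ap-+    = λ φ φ′ → *-distribˡ-+ (ψ x) (φ x) (φ′ x)
    ; ap-*    = λ c φ → lemma (ψ x) c (φ x)
    }
    where
    lemma : ∀ a c b → a * (c * b) ≡ c * (a * b)
    lemma = solve-∀ ℚ-ring

  -- `deg-linear` reduces first one factor and then the other to a monomial.
  deg-* : ∀ {n D E} {φ ψ : (Fin n → Bool) → ℚ} → HasDeg D φ → HasDeg E ψ → HasDeg (D ℕ.+ E) (λ x → φ x * ψ x)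
  deg-* {φ = φ} {ψ} hφ hψ = deg-linear (times φ) (λ T T≤E → deg-cong (λ x → *-comm (monoEval T x) (φ x))
    (deg-linear (times (monoEval T)) (λ S S≤D → deg-cong (λ x → trans (monoEval-∪ S T x) (*-comm (monoEval S x) (monoEval T x)))
      (deg-weaken (ℕ.≤-trans (size-∪ S T) (ℕ.+-mono-≤ S≤D T≤E)) (deg-mono (λ i → S i ∨ T i)))) hφ)) hψ

  point : ∀ {X} → X → Linear X
  point x = record { ap = λ φ → φ x ; ap-cong = λ e → e x ; ap-+ = λ _ _ → refl ; ap-* = λ _ _ → refl }

  deg-subst : ∀ {n k D w} (G : Fin n → BoolFn k) → (∀ i → HasDeg w (χ ∘ G i)) →
    ∀ {φ} → HasDeg D φ → HasDeg (D ℕ.* w) (λ x → φ (λ i → G i x))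
  deg-subst {w = w} G hG = deg-linear (λ x → point (λ i → G i x)) (λ S s → deg-weaken (ℕ.*-monoˡ-≤ w s) (go S G hG))
    where
    go : ∀ {n k} (S : Fin n → Bool) (G : Fin n → BoolFn k) → (∀ i → HasDeg w (χ ∘ G i)) →
      HasDeg (size S ℕ.* w) (λ x → monoEval S (λ i → G i x))
    go {zero}  S G hG = deg-const 1ℚ
    go {suc n} S G hG with S zero | go (S ∘ suc) (G ∘ suc) (hG ∘ suc)
    ... | true  | ih = deg-* (hG zero) ih
    ... | false | ih = deg-cong (λ x → sym (*-identityˡ _)) ih

  deg-var : ∀ {n} (i : Fin n) → HasDeg 1 (λ x → χ (x i))
  deg-var {suc n} zero = deg-cong (λ x → trans (cong (χ (x zero) *_) (monoEval-∅ (x ∘ suc))) (*-identityʳ _))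
    (deg-weaken (ℕ.≤-reflexive (cong suc (size-∅ n))) (deg-mono λ { zero → true ; (suc _) → false }))
  deg-var {suc n} (suc i) = deg-linear (λ x → point (x ∘ suc))
    (λ S s → deg-cong (λ x → *-identityˡ _) (deg-weaken s (deg-mono λ { zero → false ; (suc j) → S j })))
    (deg-var i)

  deg-reindex : ∀ {n k D} (σ : Fin n → Fin k) {φ} → HasDeg D φ → HasDeg D (λ x → φ (x ∘ σ))
  deg-reindex {D = D} σ h = deg-weaken (ℕ.≤-reflexive (ℕ.*-identityʳ D)) (deg-subst (λ i x → x (σ i)) (λ i → deg-var (σ i)) h)

  deg-∏ : ∀ {n k} (d : Fin n → ℕ) {φ : Fin n → (Fin k → Bool) → ℚ} →
    (∀ i → HasDeg (d i) (φ i)) → HasDeg (sum d) (λ x → ∏ (λ i → φ i x))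
  deg-∏ {zero}  d h = deg-const 1ℚ
  deg-∏ {suc n} d h = deg-* (h zero) (deg-∏ (d ∘ suc) (h ∘ suc))

-- Distributions as expectation functionals, and multilinear extensions.

module Means where

  open import Defs
  open import Data.Bool using (Bool; true; false)
  open import Data.Fin using (Fin; zero; suc; combine; remQuot)
  open import Data.Fin.Properties using (remQuot-combine)
  open import Data.Nat as ℕ using (ℕ; zero; suc)
  import Data.Nat.Properties as ℕ
  open import Data.Nat.Tactic.RingSolver using () renaming (solve-∀ to ℕ-solve-∀)
  open import Data.Product using (_×_; _,_; proj₁; proj₂; uncurry)
  open import Data.Rational
  open import Data.Rational.Properties
  open import Data.Vec.Functional using ([]; _∷_)
  open import Function using (_∘_)
  open import Relation.Binary.PropositionalEquality
  open import Tactic.RingSolver using (solve-∀)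
  import Algebra.Definitions.RawMonoid as RawMonoid
  open Rationals
  open Degree

  open RawMonoid +-0-rawMonoid using () renaming (_×_ to _·_) public

  -- A nonnegative measure in the form of its integral. Normalisation is kept apart because linear
  -- programming duality yields measures of arbitrary mass.
  record Monotone (X : Set) : Set where
    field
      linear : Linear X
    open Linear linear public
    field
      ap-mono : ∀ {φ ψ} → (∀ x → φ x ≤ ψ x) → ap φ ≤ ap ψ

  record Mean (X : Set) : Set where
    field
      monotone : Monotone X
    open Monotone monotone public
    field
      ap-1 : ap (λ _ → 1ℚ) ≡ 1ℚ

    ap-const : ∀ c → ap (λ _ → c) ≡ c
    ap-const c = trans (ap-cong (λ _ → sym (*-identityʳ c)))
      (trans (ap-* c (λ _ → 1ℚ)) (trans (cong (c *_) ap-1) (*-identityʳ c)))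

    ap-unit : ∀ {φ} → (∀ x → InUnit (φ x)) → InUnit (ap φ)
    ap-unit {φ} u =
      subst (_≤ ap φ) (ap-const 0ℚ) (ap-mono (λ x → proj₁ (u x))) ,
      subst (ap φ ≤_) ap-1 (ap-mono (λ x → proj₂ (u x)))

    ap-affine : ∀ c d φ → ap (λ x → c * φ x + d) ≡ c * ap φ + d
    ap-affine c d φ = trans (ap-+ (λ x → c * φ x) (λ _ → d)) (cong₂ _+_ (ap-* c φ) (ap-const d))

  open Mean

  pure : ∀ {X} → X → Mean X
  pure x = record { monotone = record { linear = point x ; ap-mono = λ l → l x } ; ap-1 = refl }

  bind : ∀ {X Y} → Mean X → (X → Mean Y) → Mean Y
  bind M K = record
    { monotone = record
      { linear = record
        { ap      = λ φ → ap M (λ x → ap (K x) φ)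
        ; ap-cong = λ e → ap-cong M (λ x → ap-cong (K x) e)
        ; ap-+    = λ φ ψ → trans (ap-cong M (λ x → ap-+ (K x) φ ψ)) (ap-+ M (λ x → ap (K x) φ) (λ x → ap (K x) ψ))
        ; ap-*    = λ c φ → trans (ap-cong M (λ x → ap-* (K x) c φ)) (ap-* M c (λ x → ap (K x) φ))
        }
      ; ap-mono = λ l → ap-mono M (λ x → ap-mono (K x) l)
      }
    ; ap-1 = trans (ap-cong M (λ x → ap-1 (K x))) (ap-1 M)
    }

  prod : ∀ {n X} → (Fin n → Mean X) → Mean (Fin n → X)
  prod {zero}  M = pure []
  prod {suc n} M = bind (M zero) λ x → bind (prod (M ∘ suc)) λ xs → pure (x ∷ xs)

  -- Expectations of products factor by independence.
  ap-prod-∏ : ∀ {n X} (M : Fin n → Mean X) (φ : Fin n → X → ℚ) →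
    ap (prod M) (λ x → ∏ (λ i → φ i (x i))) ≡ ∏ (λ i → ap (M i) (φ i))
  ap-prod-∏ {zero}  M φ = refl
  ap-prod-∏ {suc n} M φ = trans (ap-cong (M zero) step)
    (trans (ap-* (M zero) rest (φ zero)) (*-comm rest (ap (M zero) (φ zero))))
    where
    rest : ℚ
    rest = ∏ (λ i → ap (M (suc i)) (φ (suc i)))
    step : ∀ x → ap (prod (M ∘ suc)) (λ xs → φ zero x * ∏ (λ i → φ (suc i) (xs i))) ≡ rest * φ zero x
    step x = trans (ap-* (prod (M ∘ suc)) (φ zero x) (λ xs → ∏ (λ i → φ (suc i) (xs i))))
      (trans (cong (φ zero x *_) (ap-prod-∏ (M ∘ suc) (φ ∘ suc))) (*-comm (φ zero x) rest))

  interp : ℚ → (Bool → ℚ) → ℚ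
  interp p ψ = p * ψ true + (1ℚ - p) * ψ false

  -- The multilinear extension of `φ`, which is its expectation on independent bits of biases `y i`.
  multilinear : ∀ {k} → ((Fin k → Bool) → ℚ) → (Fin k → ℚ) → ℚ
  multilinear {zero}  φ y = φ []
  multilinear {suc k} φ y = interp (y zero) (λ b → multilinear (λ bs → φ (b ∷ bs)) (y ∘ suc))

  ap-interp : ∀ {X} (M : Mean X) (G : X → Bool) (ψ : Bool → ℚ) → ap M (ψ ∘ G) ≡ interp (ap M (χ ∘ G)) ψ
  ap-interp M G ψ = trans (ap-cong M (λ x → pointwise (G x)))
    (trans (ap-affine M (ψ true - ψ false) (ψ false) (χ ∘ G)) (lemma (ap M (χ ∘ G)) (ψ true) (ψ false)))
    where
    lemma : ∀ p s t → (s - t) * p + t ≡ p * s + (1ℚ - p) * t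
    lemma = solve-∀ ℚ-ring
    at-1 : ∀ s t → s ≡ (s - t) * 1ℚ + t
    at-1 = solve-∀ ℚ-ring
    at-0 : ∀ s t → t ≡ (s - t) * 0ℚ + t
    at-0 = solve-∀ ℚ-ring
    pointwise : ∀ u → ψ u ≡ (ψ true - ψ false) * χ u + ψ false
    pointwise true  = at-1 (ψ true) (ψ false)
    pointwise false = at-0 (ψ true) (ψ false)

  ∷-cong : ∀ {n} {A : Set} (a : A) {x y : Fin n → A} → x ≗ y → (a ∷ x) ≗ (a ∷ y)
  ∷-cong a e zero    = refl
  ∷-cong a e (suc i) = e i

  -- The bits `G (x i)` are independent, so their joint law is determined by their biases.
  ap-prod-multilinear : ∀ {n X} (M : Fin n → Mean X) (G : X → Bool) (φ : (Fin n → Bool) → ℚ) → Extensional φ →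
    ap (prod M) (λ x → φ (G ∘ x)) ≡ multilinear φ (λ i → ap (M i) (χ ∘ G))
  ap-prod-multilinear {zero}  M G φ φ-ext = φ-ext λ ()
  ap-prod-multilinear {suc n} M G φ φ-ext = trans
    (ap-cong (M zero) (λ x → trans
      (ap-cong (prod (M ∘ suc)) (λ xs → φ-ext λ { zero → refl ; (suc i) → refl }))
      (ap-prod-multilinear (M ∘ suc) G (λ bs → φ (G x ∷ bs)) (λ e → φ-ext (∷-cong (G x) e)))))
    (ap-interp (M zero) G (λ b → multilinear (λ bs → φ (b ∷ bs)) (λ i → ap (M (suc i)) (χ ∘ G))))

  interp-χ : ∀ b ψ → interp (χ b) ψ ≡ ψ b
  interp-χ true  ψ = lemma (ψ true) (ψ false)
    where
    lemma : ∀ s t → 1ℚ * s + (1ℚ - 1ℚ) * t ≡ s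
    lemma = solve-∀ ℚ-ring
  interp-χ false ψ = lemma (ψ true) (ψ false)
    where
    lemma : ∀ s t → 0ℚ * s + (1ℚ - 0ℚ) * t ≡ t
    lemma = solve-∀ ℚ-ring

  multilinear-χ : ∀ {n} {φ : (Fin n → Bool) → ℚ} → Extensional φ → ∀ x → multilinear φ (χ ∘ x) ≡ φ x
  multilinear-χ {zero}      φ-ext x = φ-ext λ ()
  multilinear-χ {suc n} {φ} φ-ext x = trans (interp-χ (x zero) (λ b → multilinear (λ bs → φ (b ∷ bs)) (χ ∘ x ∘ suc)))
    (trans (multilinear-χ (λ e → φ-ext (∷-cong (x zero) e)) (x ∘ suc)) (φ-ext λ { zero → refl ; (suc i) → refl }))

  *-≤ʳ : ∀ {a b} → a ≤ 1ℚ → 0ℚ ≤ b → a * b ≤ b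
  *-≤ʳ {a} {b} a≤1 0≤b = subst (a * b ≤_) (*-identityˡ b) (*-monoʳ 0≤b a≤1)

  *-≤ˡ : ∀ {a b} → 0ℚ ≤ a → b ≤ 1ℚ → a * b ≤ a
  *-≤ˡ {a} {b} 0≤a b≤1 = subst (a * b ≤_) (*-identityʳ a) (*-monoˡ 0≤a b≤1)

  interp-unit : ∀ {p ψ} → InUnit p → (∀ b → InUnit (ψ b)) → InUnit (interp p ψ)
  interp-unit {p} {ψ} (0≤p , p≤1) u with u true | u false
  ... | 0≤s , s≤1 | 0≤t , t≤1 =
    +-nonneg (*-nonneg 0≤p 0≤s) (*-nonneg (0≤diff p≤1) 0≤t) ,
    subst (interp p ψ ≤_) (lemma p) (+-mono-≤ (*-≤ˡ 0≤p s≤1) (*-≤ˡ (0≤diff p≤1) t≤1))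
    where
    lemma : ∀ p → p + (1ℚ - p) ≡ 1ℚ
    lemma = solve-∀ ℚ-ring

  err-interp : ∀ v p ψ → err v (interp p ψ) ≡ interp p (err v ∘ ψ)
  err-interp false p ψ = refl
  err-interp true  p ψ = lemma p (ψ true) (ψ false)
    where
    lemma : ∀ p s t → 1ℚ - (p * s + (1ℚ - p) * t) ≡ p * (1ℚ - s) + (1ℚ - p) * (1ℚ - t)
    lemma = solve-∀ ℚ-ring

  interp-close : ∀ {c e b v p ψ} → Close c b p → (∀ u → InUnit (ψ u)) → err v (ψ b) ≤ e → Close (c + e) v (interp p ψ)
  interp-close {c} {e} {b} {v} {p} {ψ} (close (0≤p , p≤1) near) u h =
    close (interp-unit (0≤p , p≤1) u) (subst (_≤ c + e) (sym (err-interp v p ψ)) (bound′ b near h))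
    where
    bound′ : ∀ b → err b p ≤ c → err v (ψ b) ≤ e → interp p (err v ∘ ψ) ≤ c + e
    bound′ b near h with err-unit v (u true) | err-unit v (u false)
    bound′ true near h | 0≤s , s≤1 | 0≤t , t≤1 = subst (interp p (err v ∘ ψ) ≤_) (+-comm e c)
      (+-mono-≤ (≤-trans (*-≤ʳ p≤1 0≤s) h) (≤-trans (*-≤ˡ (0≤diff p≤1) t≤1) near))
    bound′ false near h | 0≤s , s≤1 | 0≤t , t≤1 =
      +-mono-≤ (≤-trans (*-≤ˡ 0≤p s≤1) near) (≤-trans (*-≤ʳ {1ℚ - p} (≤-diff p (lemma p) 0≤p) 0≤t) h)
      where
      lemma : ∀ p → 1ℚ ≡ 1ℚ - p + p
      lemma = solve-∀ ℚ-ring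

  multilinear-unit : ∀ {k φ} {y : Fin k → ℚ} → (∀ x → InUnit (φ x)) → (∀ i → InUnit (y i)) → InUnit (multilinear φ y)
  multilinear-unit {zero}  u w = u _
  multilinear-unit {suc k} u w = interp-unit (w zero) (λ b → multilinear-unit (λ bs → u (b ∷ bs)) (w ∘ suc))

  -- The union bound: outside an event of probability at most `k · c` all bits agree with `b`. Each
  -- coordinate contributes one use of `interp-close`.
  multilinear-close : ∀ {k c v} {φ : (Fin k → Bool) → ℚ} {y b} → Extensional φ → (∀ x → InUnit (φ x)) →
    (∀ i → Close c (b i) (y i)) → φ b ≡ χ v → Close (k · c) v (multilinear φ y)
  multilinear-close {zero} {v = v} {φ} φ-ext u near e =
    close (u _) (≤-reflexive (trans (cong (err v) (trans (φ-ext λ ()) e)) (err-χ v)))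
  multilinear-close {suc k} {v = v} {φ} {y} {b} φ-ext u near e =
    interp-close {ψ = λ b → multilinear (λ bs → φ (b ∷ bs)) (y ∘ suc)} (near zero)
      (λ a → multilinear-unit (λ bs → u (a ∷ bs)) (unit ∘ near ∘ suc))
      (bound (multilinear-close {v = v} {b = b ∘ suc} (λ e → φ-ext (∷-cong (b zero) e)) (λ bs → u (b zero ∷ bs)) (near ∘ suc)
        (trans (φ-ext λ { zero → refl ; (suc i) → refl }) e)))

  deg-1- : ∀ {n D} {φ : (Fin n → Bool) → ℚ} → HasDeg D φ → HasDeg D (λ x → 1ℚ - φ x)
  deg-1- {φ = φ} h = deg-cong (λ x → lemma (φ x)) (deg-+ (deg-weaken ℕ.z≤n (deg-const 1ℚ)) (deg-scale (- 1ℚ) h))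
    where
    lemma : ∀ a → 1ℚ + (- 1ℚ) * a ≡ 1ℚ - a
    lemma = solve-∀ ℚ-ring

  deg-multilinear : ∀ {k n r} (φ : (Fin k → Bool) → ℚ) {y : Fin k → (Fin n → Bool) → ℚ} → (∀ i → HasDeg r (y i)) →
    HasDeg (k ℕ.* r) (λ x → multilinear φ (λ i → y i x))
  deg-multilinear {zero}  φ h = deg-const _
  deg-multilinear {suc k} φ h = deg-+ (deg-* (h zero) (deg-multilinear (λ bs → φ (true ∷ bs)) (h ∘ suc)))
    (deg-* (deg-1- (h zero)) (deg-multilinear (λ bs → φ (false ∷ bs)) (h ∘ suc)))

  deg-maj : ∀ {n r} {φ : (Fin n → Bool) → ℚ} → HasDeg r φ → HasDeg (3 ℕ.* r) (λ x → majBias (φ x))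
  deg-maj {r = r} {φ} h = deg-cong (λ x → lemma (φ x)) (deg-weaken (ℕ.≤-reflexive (triple r))
    (deg-* (deg-* h h) (deg-+ (deg-weaken ℕ.z≤n (deg-const 3ℚ)) (deg-scale (- 2ℚ) h))))
    where
    lemma : ∀ y → y * y * (3ℚ + (- 2ℚ) * y) ≡ majBias y
    lemma y = cong (λ z → y * y * (3ℚ + z)) (sym (neg-distribˡ-* 2ℚ y))
    triple : ∀ r → r ℕ.+ r ℕ.+ r ≡ 3 ℕ.* r
    triple = ℕ-solve-∀

  flatten : ∀ {n m} {A : Set} → (Fin n → Fin m → A) → Fin (n ℕ.* m) → A
  flatten {m = m} x = uncurry x ∘ remQuot m

  flatten-combine : ∀ {n m} {A : Set} (x : Fin n → Fin m → A) i → flatten x ∘ combine i ≗ x i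
  flatten-combine x i j = cong (uncurry x) (remQuot-combine i j)

  blocks : ∀ {n m} → (Fin n → Mean (Fin m → Bool)) → Mean (Fin (n ℕ.* m) → Bool)
  blocks M = bind (prod M) (pure ∘ flatten)

  ap-blocks-mono : ∀ {n m} (M : Fin n → Mean (Fin m → Bool)) S →
    ap (blocks M) (monoEval S) ≡ ∏ (λ i → ap (M i) (monoEval (S ∘ combine {n} i)))
  ap-blocks-mono {n} M S = trans
    (ap-cong (prod M) (λ x → trans (monoEval-combine n S (flatten x))
      (∏-cong (λ i → monoEval-cong {S = S ∘ combine {n} i} (λ _ → refl) (flatten-combine x i)))))
    (ap-prod-∏ M (λ i → monoEval (S ∘ combine {n} i)))

  -- The blocks are sampled independently, so `f` sees independent bits and each block enters
  -- through the bias of `G` on it.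
  ap-blocks-⊚ : ∀ {n m} (M : Fin n → Mean (Fin m → Bool)) (f : BoolFn n) (G : BoolFn m) →
    Extensional f → Extensional G →
    ap (blocks M) (χ ∘ (f ⊚ G)) ≡ multilinear (χ ∘ f) (λ i → ap (M i) (χ ∘ G))
  ap-blocks-⊚ M f G f-ext G-ext = trans
    (ap-cong (prod M) (λ x → cong χ (f-ext (λ i → G-ext (flatten-combine x i)))))
    (ap-prod-multilinear M G (χ ∘ f) (cong χ ∘ f-ext))

-- Farkas' lemma by Fourier-Motzkin elimination.

module FourierMotzkin where

  import Data.List as List
  open import Data.List using (List; []; _∷_; _++_; cartesianProductWith)
  open import Data.List.Membership.Propositional using (_∈_; find)
  open import Data.List.Membership.Propositional.Properties using (∈-++⁺ˡ; ∈-cartesianProductWith⁺)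
  open import Data.List.Relation.Unary.All as All using (All; []; _∷_)
  import Data.List.Relation.Unary.All.Properties as All
  open import Data.List.Relation.Unary.Any using (here)
  open import Data.Nat using (ℕ; zero; suc)
  open import Data.Product using (_×_; _,_; ∃; ∃-syntax; proj₁; proj₂)
  open import Data.Rational
  open import Data.Rational.Properties
  open import Data.Sum using (_⊎_; inj₁; inj₂)
  open import Data.Vec using (Vec; []; _∷_; zipWith; replicate; map)
  open import Relation.Binary.Definitions using (tri<; tri≈; tri>)
  open import Relation.Binary.PropositionalEquality
  open import Relation.Nullary using (yes; no)
  open import Tactic.RingSolver using (solve-∀)
  open Rationals

  infixl 6 _⊕_
  infixl 7 _∙_ _⊗_

  _⊕_ : ∀ {n} → Vec ℚ n → Vec ℚ n → Vec ℚ n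
  _⊕_ = zipWith _+_

  _⊗_ : ∀ {n} → ℚ → Vec ℚ n → Vec ℚ n
  c ⊗ a = map (c *_) a

  𝟎 : ∀ {n} → Vec ℚ n
  𝟎 = replicate _ 0ℚ

  _∙_ : ∀ {n} → Vec ℚ n → Vec ℚ n → ℚ
  []      ∙ []      = 0ℚ
  (a ∷ u) ∙ (b ∷ v) = a * b + u ∙ v

  ⊕-∙ : ∀ {n} (u v x : Vec ℚ n) → (u ⊕ v) ∙ x ≡ u ∙ x + v ∙ x
  ⊕-∙ []      []      []      = refl
  ⊕-∙ (a ∷ u) (b ∷ v) (c ∷ x) = trans (cong ((a + b) * c +_) (⊕-∙ u v x)) (lemma a b c (u ∙ x) (v ∙ x))
    where
    lemma : ∀ a b c s t → (a + b) * c + (s + t) ≡ a * c + s + (b * c + t)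
    lemma = solve-∀ ℚ-ring

  ⊗-∙ : ∀ {n} c (u x : Vec ℚ n) → (c ⊗ u) ∙ x ≡ c * (u ∙ x)
  ⊗-∙ c []      []      = sym (*-zeroʳ c)
  ⊗-∙ c (a ∷ u) (b ∷ x) = trans (cong (c * a * b +_) (⊗-∙ c u x)) (lemma c a b (u ∙ x))
    where
    lemma : ∀ c a b s → c * a * b + c * s ≡ c * (a * b + s)
    lemma = solve-∀ ℚ-ring

  Inequality : ℕ → Set
  Inequality n = Vec ℚ n × ℚ

  _⊨_ : ∀ {n} → Vec ℚ n → Inequality n → Set
  x ⊨ (a , b) = a ∙ x ≤ b

  -- Derivations are kept as data so that the multipliers of a refutation can be extracted by
  -- induction.
  data Cone {n} (Γ : List (Inequality n)) : Inequality n → Set where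
    gen : ∀ {ι} → ι ∈ Γ → Cone Γ ι
    add : ∀ {a b a′ b′} → Cone Γ (a , b) → Cone Γ (a′ , b′) → Cone Γ (a ⊕ a′ , b + b′)
    scl : ∀ c {a b} → 0ℚ ≤ c → Cone Γ (a , b) → Cone Γ (c ⊗ a , c * b)

  -- The point is the maximum of `L` and some lower bound of `U`; it stays below `U` because every
  -- element of `L` does.
  between : ∀ (L U : List ℚ) → All (λ l → All (l ≤_) U) L → ∃[ x ] (All (_≤ x) L × All (x ≤_) U)
  between [] []      _ = 0ℚ , [] , []
  between [] (u ∷ U) _ with between [] U []
  ... | x , _ , x≤U = u ⊓ x , [] , p⊓q≤p u x ∷ All.map (≤-trans (p⊓q≤q u x)) x≤U
  between (l ∷ L) U (l≤U ∷ L≤U) with between L U L≤U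
  ... | x , L≤x , x≤U = l ⊔ x , p≤p⊔q l x ∷ All.map (λ h → ≤-trans h (p≤q⊔p l x)) L≤x ,
    All.zipWith (λ (l≤u , x≤u) → ⊔-lub l≤u x≤u) (l≤U , x≤U)

  -- The inequalities of Γ solved for the first variable: a ∙ x - b ≤ x₀ for (a , b) in lower,
  -- x₀ ≤ b - a ∙ x for (a , b) in upper, and a ∙ x ≤ b for (a , b) in free.
  record Split {n} (Γ₀ Γ : List (Inequality (suc n))) : Set where
    field
      lower upper free : List (Inequality n)
      lower-cone : All (λ (a , b) → Cone Γ₀ (- 1ℚ ∷ a , b)) lower
      upper-cone : All (λ (a , b) → Cone Γ₀ (1ℚ ∷ a , b)) upper
      free-cone  : All (λ (a , b) → Cone Γ₀ (0ℚ ∷ a , b)) free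
      sound : ∀ x₀ x → All (λ (a , b) → a ∙ x - b ≤ x₀) lower → All (λ (a , b) → x₀ ≤ b - a ∙ x) upper →
        All (x ⊨_) free → All ((x₀ ∷ x) ⊨_) Γ

  split : ∀ {n} (Γ₀ Γ : List (Inequality (suc n))) → All (Cone Γ₀) Γ → Split Γ₀ Γ
  split Γ₀ [] [] = record
    { lower = [] ; upper = [] ; free = [] ; lower-cone = [] ; upper-cone = [] ; free-cone = []
    ; sound = λ _ _ _ _ _ → [] }
  split Γ₀ ((a₀ ∷ a , b) ∷ Γ) (k ∷ ks) with <-cmp a₀ 0ℚ | split Γ₀ Γ ks
  ... | tri≈ _ refl _ | σ = record
    { lower = lower ; upper = upper ; free = (a , b) ∷ free
    ; lower-cone = lower-cone ; upper-cone = upper-cone ; free-cone = k ∷ free-cone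
    ; sound = λ { x₀ x l u (f ∷ fs) → subst (_≤ b) (lemma x₀ (a ∙ x)) f ∷ sound x₀ x l u fs } }
    where
    open Split σ
    lemma : ∀ x₀ s → s ≡ 0ℚ * x₀ + s
    lemma = solve-∀ ℚ-ring
  -- Division by the positive number `- a₀` preserves the direction of the inequality and makes the
  -- leading coefficient -1.
  ... | tri< a₀<0 _ _ | σ = record
    { lower = (r ⊗ a , r * b) ∷ lower ; upper = upper ; free = free
    ; lower-cone = subst (λ c → Cone Γ₀ (c ∷ r ⊗ a , r * b)) ra₀ (scl r 0≤r k) ∷ lower-cone
    ; upper-cone = upper-cone ; free-cone = free-cone
    ; sound = λ { x₀ x (l ∷ ls) u f → solves x₀ x l ∷ sound x₀ x ls u f } }
    where
    open Split σ
    instance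
      a₀-pos : Positive (- a₀)
      a₀-pos = positive (neg-antimono-< a₀<0)
      a₀-nonzero : NonZero (- a₀)
      a₀-nonzero = pos⇒nonZero (- a₀)
    r : ℚ
    r = 1/ (- a₀)
    0≤r : 0ℚ ≤ r
    0≤r = <⇒≤ (positive⁻¹ r {{1/pos⇒pos (- a₀)}})
    ra₀ : r * a₀ ≡ - 1ℚ
    ra₀ = trans (lemma r a₀) (cong -_ (*-inverseˡ (- a₀)))
      where
      lemma : ∀ r a → r * a ≡ - (r * (- a))
      lemma = solve-∀ ℚ-ring
    solves : ∀ x₀ x → (r ⊗ a) ∙ x - r * b ≤ x₀ → a₀ * x₀ + a ∙ x ≤ b
    solves x₀ x l = diff≤ (subst (0ℚ ≤_) eq (*-nonneg (<⇒≤ (neg-antimono-< a₀<0)) (0≤diff l)))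
      where
      lemma : ∀ a₀ r s b x₀ → - a₀ * (x₀ - (r * s - r * b)) ≡ - (a₀ * x₀) + (r * (- a₀)) * (b - s)
      lemma = solve-∀ ℚ-ring
      lemma₂ : ∀ t s b → - t + 1ℚ * (b - s) ≡ b - (t + s)
      lemma₂ = solve-∀ ℚ-ring
      eq : - a₀ * (x₀ - ((r ⊗ a) ∙ x - r * b)) ≡ b - (a₀ * x₀ + a ∙ x)
      eq = trans (cong (λ s → - a₀ * (x₀ - (s - r * b))) (⊗-∙ r a x))
        (trans (lemma a₀ r (a ∙ x) b x₀) (trans (cong (λ t → - (a₀ * x₀) + t * (b - a ∙ x)) (*-inverseˡ (- a₀)))
          (lemma₂ (a₀ * x₀) (a ∙ x) b)))
  ... | tri> _ _ a₀>0 | σ = record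
    { lower = lower ; upper = (r ⊗ a , r * b) ∷ upper ; free = free
    ; lower-cone = lower-cone
    ; upper-cone = subst (λ c → Cone Γ₀ (c ∷ r ⊗ a , r * b)) (*-inverseˡ a₀) (scl r 0≤r k) ∷ upper-cone
    ; free-cone = free-cone
    ; sound = λ { x₀ x l (u ∷ us) f → solves x₀ x u ∷ sound x₀ x l us f } }
    where
    open Split σ
    instance
      a₀-pos : Positive a₀
      a₀-pos = positive a₀>0
      a₀-nonzero : NonZero a₀
      a₀-nonzero = pos⇒nonZero a₀
    r : ℚ
    r = 1/ a₀
    0≤r : 0ℚ ≤ r
    0≤r = <⇒≤ (positive⁻¹ r {{1/pos⇒pos a₀}})
    solves : ∀ x₀ x → x₀ ≤ r * b - (r ⊗ a) ∙ x → a₀ * x₀ + a ∙ x ≤ b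
    solves x₀ x u = diff≤ (subst (0ℚ ≤_) eq (*-nonneg (<⇒≤ a₀>0) (0≤diff u)))
      where
      lemma : ∀ a₀ r s b x₀ → a₀ * (r * b - r * s - x₀) ≡ (r * a₀) * (b - s) - a₀ * x₀
      lemma = solve-∀ ℚ-ring
      lemma₂ : ∀ t s b → 1ℚ * (b - s) - t ≡ b - (t + s)
      lemma₂ = solve-∀ ℚ-ring
      eq : a₀ * (r * b - (r ⊗ a) ∙ x - x₀) ≡ b - (a₀ * x₀ + a ∙ x)
      eq = trans (cong (λ s → a₀ * (r * b - s - x₀)) (⊗-∙ r a x))
        (trans (lemma a₀ r (a ∙ x) b x₀) (trans (cong (λ t → t * (b - a ∙ x) - a₀ * x₀) (*-inverseˡ a₀))
          (lemma₂ (a₀ * x₀) (a ∙ x) b)))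

  -- A refutation of the reduced system refutes the original one, since the eliminated variable has
  -- coefficient 0 throughout.
  Cone-lift : ∀ {n} {Γ : List (Inequality (suc n))} {Δ : List (Inequality n)} →
    All (λ (a , b) → Cone Γ (0ℚ ∷ a , b)) Δ → ∀ {a b} → Cone Δ (a , b) → Cone Γ (0ℚ ∷ a , b)
  Cone-lift h (gen ι∈Δ)              = All.lookup h ι∈Δ
  Cone-lift h (add k k′)             = add (Cone-lift h k) (Cone-lift h k′)
  Cone-lift {Γ = Γ} h (scl c {a} {b} 0≤c k) =
    subst (λ z → Cone Γ (z ∷ c ⊗ a , c * b)) (*-zeroʳ c) (scl c 0≤c (Cone-lift h k))

  _⊞_ : ∀ {n} → Inequality n → Inequality n → Inequality n
  (a , b) ⊞ (a′ , b′) = a ⊕ a′ , b + b′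

  -- Induction on the number of variables. Adding every lower bound on the first variable to every
  -- upper bound eliminates it, and a solution of the resulting system leaves room for a value
  -- between them.
  farkas : ∀ {n} (Γ : List (Inequality n)) → (∃[ x ] All (x ⊨_) Γ) ⊎ (∃[ b ] (b < 0ℚ × Cone Γ (𝟎 , b)))
  -- Without variables every inequality reads `0 ≤ b`.
  farkas {zero} Γ with All.all? (λ (a , b) → 0ℚ ≤? b) Γ
  ... | yes h = inj₁ ([] , All.map (λ { {[] , b} 0≤b → 0≤b }) h)
  ... | no ¬h with All.¬All⇒Any¬ (λ (a , b) → 0ℚ ≤? b) Γ ¬h
  ... | any with find any
  ... | ([] , b) , ι∈Γ , b≱0 = inj₂ (b , ≰⇒> b≱0 , gen ι∈Γ)
  farkas {suc n} Γ = solve (farkas Δ)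
    where
    open Split (split Γ Γ (All.tabulate gen))
    Δ : List (Inequality n)
    Δ = cartesianProductWith _⊞_ lower upper ++ free
    Δ-cone : All (λ (a , b) → Cone Γ (0ℚ ∷ a , b)) Δ
    Δ-cone = All.++⁺ (All.cartesianProductWith⁺ (setoid _) (setoid _) _⊞_ lower upper
      λ l∈ u∈ → add (All.lookup lower-cone l∈) (All.lookup upper-cone u∈)) free-cone
    solve : (∃[ x ] All (x ⊨_) Δ) ⊎ (∃[ b ] (b < 0ℚ × Cone Δ (𝟎 , b))) → _
    solve (inj₂ (b , b<0 , k)) = inj₂ (b , b<0 , Cone-lift Δ-cone k)
    solve (inj₁ (x , h)) = inj₁ (x₀ ∷ x , sound x₀ x (All.map⁻ (proj₁ (proj₂ mid))) (All.map⁻ (proj₂ (proj₂ mid)))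
        (All.++⁻ʳ (cartesianProductWith _⊞_ lower upper) h))
      where
      below above : Inequality n → ℚ
      below (a , b) = a ∙ x - b
      above (a , b) = b - a ∙ x
      lemma : ∀ s b t c → b + c - (s + t) ≡ (c - t) - (s - b)
      lemma = solve-∀ ℚ-ring
      cross : ∀ {ι κ} → ι ∈ lower → κ ∈ upper → below ι ≤ above κ
      cross {a , b} {a′ , b′} l∈ u∈ = diff≤ (subst (0ℚ ≤_)
        (trans (cong (λ s → b + b′ - s) (⊕-∙ a a′ x)) (lemma (a ∙ x) b (a′ ∙ x) b′))
        (0≤diff (All.lookup h (∈-++⁺ˡ (∈-cartesianProductWith⁺ _⊞_ l∈ u∈)))))
      mid = between (List.map below lower) (List.map above upper)
        (All.map⁺ (All.tabulate λ l∈ → All.map⁺ (All.tabulate λ u∈ → cross l∈ u∈)))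
      x₀ = proj₁ mid

-- Dual witnesses for approximate degree.

module Duality where

  open import Defs
  open import Data.Bool using (Bool; true; false)
  open import Data.Fin using (Fin; zero; suc)
  open import Data.Integer using (+_)
  open import Data.List using (List; []; _∷_; map; _++_; filter; length)
  open import Data.List.Membership.Propositional using (_∈_)
  open import Data.List.Membership.Propositional.Properties using (∈-++⁺ˡ; ∈-++⁺ʳ; ∈-++⁻; ∈-map⁺; ∈-map⁻; ∈-filter⁺)
  open import Data.List.Relation.Unary.All as All using (All; []; _∷_)
  import Data.List.Relation.Unary.All.Properties as All
  open import Data.List.Relation.Unary.Any using (here)
  open import Data.Nat as ℕ using (ℕ; zero; suc)
  import Data.Nat.Properties as ℕ
  open import Data.Product using (_×_; _,_; ∃₂; ∃-syntax; proj₁; proj₂)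
  open import Data.Rational
  open import Data.Rational.Properties
  open import Data.Sum using (_⊎_; inj₁; inj₂)
  import Data.Vec as Vec
  open Vec using (Vec)
  open import Data.Vec.Properties using (∷-injective)
  open import Data.Vec.Functional using () renaming (_∷_ to _◂_)
  open import Function using (_∘_)
  open import Relation.Binary.PropositionalEquality
  open import Relation.Nullary using (Dec)
  open import Tactic.RingSolver using (solve-∀)
  open Rationals
  open Degree
  open Means
  open FourierMotzkin

  open Monotone
  open Mean using () renaming (ap to E)

  record Dual {m} (G : BoolFn m) (w : ℕ) (c : ℚ) : Set where
    field
      μ     : Bool → Mean (Fin m → Bool)
      agree : ∀ S → size S ℕ.< w → E (μ true) (monoEval S) ≡ E (μ false) (monoEval S)
      near  : ∀ b → err b (E (μ b) (χ ∘ G)) ≤ c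

  cube : ∀ n → List (Fin n → Bool)
  cube zero    = (λ ()) ∷ []
  cube (suc n) = map (true ◂_) (cube n) ++ map (false ◂_) (cube n)

  ∈-cube : ∀ {n} (x : Fin n → Bool) → ∃[ y ] (y ∈ cube n × x ≗ y)
  ∈-cube {zero}  x = _ , here refl , λ ()
  ∈-cube {suc n} x with x zero in eq | ∈-cube (x ∘ suc)
  ... | true  | y , y∈ , e = true ◂ y , ∈-++⁺ˡ (∈-map⁺ (true ◂_) y∈) , λ { zero → eq ; (suc i) → e i }
  ... | false | y , y∈ , e = false ◂ y , ∈-++⁺ʳ _ (∈-map⁺ (false ◂_) y∈) , λ { zero → eq ; (suc i) → e i }

  pointᴹ : ∀ {X} → X → Monotone X
  pointᴹ x = record { linear = point x ; ap-mono = λ l → l x }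

  zeroᴹ : ∀ {X} → Monotone X
  zeroᴹ = record
    { linear = record { ap = λ _ → 0ℚ ; ap-cong = λ _ → refl ; ap-+ = λ _ _ → refl ; ap-* = λ c _ → sym (*-zeroʳ c) }
    ; ap-mono = λ _ → ≤-refl }

  _+ᴹ_ : ∀ {X} → Monotone X → Monotone X → Monotone X
  P +ᴹ Q = record
    { linear = record
      { ap      = λ φ → ap P φ + ap Q φ
      ; ap-cong = λ e → cong₂ _+_ (ap-cong P e) (ap-cong Q e)
      ; ap-+    = λ φ ψ → trans (cong₂ _+_ (ap-+ P φ ψ) (ap-+ Q φ ψ)) (swap (ap P φ) (ap P ψ) (ap Q φ) (ap Q ψ))
      ; ap-*    = λ c φ → trans (cong₂ _+_ (ap-* P c φ) (ap-* Q c φ)) (sym (*-distribˡ-+ c (ap P φ) (ap Q φ)))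
      }
    ; ap-mono = λ l → +-mono-≤ (ap-mono P l) (ap-mono Q l) }
    where
    swap : ∀ a b c d → a + b + (c + d) ≡ a + c + (b + d)
    swap = solve-∀ ℚ-ring

  scaleᴹ : ∀ {X} c → 0ℚ ≤ c → Monotone X → Monotone X
  scaleᴹ c 0≤c P = record
    { linear = record
      { ap      = λ φ → c * ap P φ
      ; ap-cong = λ e → cong (c *_) (ap-cong P e)
      ; ap-+    = λ φ ψ → trans (cong (c *_) (ap-+ P φ ψ)) (*-distribˡ-+ c (ap P φ) (ap P ψ))
      ; ap-*    = λ d φ → trans (cong (c *_) (ap-* P d φ)) (swap c d (ap P φ))
      }
    ; ap-mono = λ l → *-monoˡ 0≤c (ap-mono P l) }
    where
    swap : ∀ c d a → c * (d * a) ≡ d * (c * a)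
    swap = solve-∀ ℚ-ring

  ap-nonneg : ∀ {X} (P : Monotone X) {φ} → (∀ x → 0ℚ ≤ φ x) → 0ℚ ≤ ap P φ
  ap-nonneg P {φ} h = subst (_≤ ap P φ) (ap-0 P) (ap-mono P h)

  module _ {m : ℕ} (G : BoolFn m) (w : ℕ) where

    ⅓ : ℚ
    ⅓ = + 1 / 3

    -- Constraint vectors are values of a functional at monomials, so that a combination of
    -- constraints is a combination of point evaluations.
    coords : (Ss : List (Fin m → Bool)) → (((Fin m → Bool) → ℚ) → ℚ) → Vec ℚ (length Ss)
    coords []       L = Vec.[]
    coords (S ∷ Ss) L = L (monoEval S) Vec.∷ coords Ss L

    coords-cong : ∀ Ss {L L′} → L ≗ L′ → coords Ss L ≡ coords Ss L′
    coords-cong []       e = refl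
    coords-cong (S ∷ Ss) e = cong₂ Vec._∷_ (e (monoEval S)) (coords-cong Ss e)

    coords-⊕ : ∀ Ss L L′ → coords Ss L ⊕ coords Ss L′ ≡ coords Ss (λ φ → L φ + L′ φ)
    coords-⊕ []       L L′ = refl
    coords-⊕ (S ∷ Ss) L L′ = cong (_ Vec.∷_) (coords-⊕ Ss L L′)

    coords-⊗ : ∀ Ss c L → c ⊗ coords Ss L ≡ coords Ss (λ φ → c * L φ)
    coords-⊗ []       c L = refl
    coords-⊗ (S ∷ Ss) c L = cong (_ Vec.∷_) (coords-⊗ Ss c L)

    coords-𝟎 : ∀ Ss L → 𝟎 ≡ coords Ss L → All (λ S → 0ℚ ≡ L (monoEval S)) Ss
    coords-𝟎 []       L e = []
    coords-𝟎 (S ∷ Ss) L e with ∷-injective e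
    ... | e₀ , es = e₀ ∷ coords-𝟎 Ss L es

    toPoly : ∀ (Ss : List (Fin m → Bool)) → Vec ℚ (length Ss) → Poly m
    toPoly []       Vec.[]       = []
    toPoly (S ∷ Ss) (c Vec.∷ cs) = (c , S) ∷ toPoly Ss cs

    eval-toPoly : ∀ (Ss : List (Fin m → Bool)) (cs : Vec ℚ (length Ss)) x → eval (toPoly Ss cs) x ≡ coords Ss (λ φ → φ x) ∙ cs
    eval-toPoly []       Vec.[]       x = refl
    eval-toPoly (S ∷ Ss) (c Vec.∷ cs) x = cong₂ _+_ (*-comm c (monoEval S x)) (eval-toPoly Ss cs x)

    toPoly-deg : ∀ (Ss : List (Fin m → Bool)) (cs : Vec ℚ (length Ss)) → All (λ S → size S ℕ.≤ w) Ss → DegreeAtMost w (toPoly Ss cs)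
    toPoly-deg []       Vec.[]       []       = []
    toPoly-deg (S ∷ Ss) (c Vec.∷ cs) (s ∷ ss) = s ∷ toPoly-deg Ss cs ss

    low? : (S : Fin m → Bool) → Dec (size S ℕ.≤ w)
    low? S = size S ℕ.≤? w

    low : List (Fin m → Bool)
    low = filter low? (cube m)

    -- The unknowns are the coefficients of a polynomial p of degree at most `w`; the constraints
    -- are p(x) ≤ G(x) + 1/3 and -p(x) ≤ -(G(x) - 1/3).
    upperAt lowerAt : (Fin m → Bool) → Inequality (length low)
    upperAt x = coords low (λ φ → φ x) , χ (G x) + ⅓
    lowerAt x = coords low (λ φ → - 1ℚ * φ x) , - 1ℚ * (χ (G x) - ⅓)

    system : List (Inequality (length low))
    system = map upperAt (cube m) ++ map lowerAt (cube m)

    -- `P` collects the multipliers of the upper constraints as a measure on inputs, `Q` those of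
    -- the lower constraints.
    Certified : Inequality (length low) → Set
    Certified (a , b) = ∃₂ λ (P Q : Monotone (Fin m → Bool)) →
      a ≡ coords low (λ φ → ap P φ - ap Q φ) × b ≡ ap P (λ x → χ (G x) + ⅓) - ap Q (λ x → χ (G x) - ⅓)

    certify : ∀ {a b} → Cone system (a , b) → Certified (a , b)
    certify (gen ι∈) with ∈-++⁻ (map upperAt (cube m)) ι∈
    ... | inj₁ ∈u with ∈-map⁻ upperAt ∈u
    ...   | x , _ , refl = pointᴹ x , zeroᴹ , coords-cong low (λ φ → lemma (φ x)) , lemma (χ (G x) + ⅓)
      where
      lemma : ∀ a → a ≡ a - 0ℚ
      lemma = solve-∀ ℚ-ring
    certify (gen ι∈) | inj₂ ∈l with ∈-map⁻ lowerAt ∈l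
    ...   | x , _ , refl = zeroᴹ , pointᴹ x , coords-cong low (λ φ → lemma (φ x)) , lemma (χ (G x) - ⅓)
      where
      lemma : ∀ a → - 1ℚ * a ≡ 0ℚ - a
      lemma = solve-∀ ℚ-ring
    certify (add k k′) with certify k | certify k′
    ... | P , Q , refl , refl | P′ , Q′ , refl , refl = P +ᴹ P′ , Q +ᴹ Q′ ,
      trans (coords-⊕ low _ _) (coords-cong low (λ φ → lemma (ap P φ) (ap Q φ) (ap P′ φ) (ap Q′ φ))) ,
      lemma (ap P _) (ap Q _) (ap P′ _) (ap Q′ _)
      where
      lemma : ∀ a b c d → a - b + (c - d) ≡ a + c - (b + d)
      lemma = solve-∀ ℚ-ring
    certify (scl c 0≤c k) with certify k
    ... | P , Q , refl , refl = scaleᴹ c 0≤c P , scaleᴹ c 0≤c Q ,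
      trans (coords-⊗ low c _) (coords-cong low (λ φ → lemma c (ap P φ) (ap Q φ))) ,
      lemma c (ap P _) (ap Q _)
      where
      lemma : ∀ c a b → c * (a - b) ≡ c * a - c * b
      lemma = solve-∀ ℚ-ring

    -- Agreement on the empty monomial gives both measures the same mass `s`, and the separation
    -- says that q - p > 2s/3. As p ≥ 0 and q ≤ s, normalisation yields q/s > 2/3 and p/s < 1/3: `Q`
    -- becomes the distribution for the bit 1 and `P` the one for 0.
    module _ (P Q : Monotone (Fin m → Bool))
      (agrees : ∀ S → size S ℕ.≤ w → ap P (monoEval S) ≡ ap Q (monoEval S))
      (separated : ap P (λ x → χ (G x) + ⅓) - ap Q (λ x → χ (G x) - ⅓) < 0ℚ) where

      s p q : ℚ
      s = ap Q (λ _ → 1ℚ)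
      p = ap P (χ ∘ G)
      q = ap Q (χ ∘ G)

      mass : ap P (λ _ → 1ℚ) ≡ s
      mass = trans (ap-cong P (λ x → sym (monoEval-∅ x)))
        (trans (agrees (λ _ → false) (subst (ℕ._≤ w) (sym (size-∅ m)) ℕ.z≤n)) (ap-cong Q monoEval-∅))

      ap-shift : ∀ (R : Monotone (Fin m → Bool)) c → ap R (λ x → χ (G x) + c) ≡ ap R (χ ∘ G) + c * ap R (λ _ → 1ℚ)
      ap-shift R c = trans (ap-+ R (χ ∘ G) (λ _ → c)) (cong (λ t → ap R (χ ∘ G) + t)
        (trans (ap-cong R (λ _ → sym (*-identityʳ c))) (ap-* R c (λ _ → 1ℚ))))

      gap : 0ℚ < q - p - (+ 2 / 3) * s
      gap = subst (0ℚ <_) (trans (cong -_ (cong₂ _-_ (trans (ap-shift P ⅓) (cong (λ t → p + ⅓ * t) mass)) (ap-shift Q (- ⅓)))) (lemma p q s))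
        (neg-antimono-< separated)
        where
        lemma : ∀ p q s → - (p + (+ 1 / 3) * s - (q + (- (+ 1 / 3)) * s)) ≡ q - p - (+ 2 / 3) * s
        lemma = solve-∀ ℚ-ring

      0≤p : 0ℚ ≤ p
      0≤p = ap-nonneg P (λ x → proj₁ (χ-unit (G x)))

      q≤s : q ≤ s
      q≤s = ap-mono Q (λ x → proj₂ (χ-unit (G x)))

      -- The positive gap is at most s/3.
      0<s : 0ℚ < s
      0<s = *-cancelˡ-<-nonNeg ⅓ (subst (_< ⅓ * s) (sym (*-zeroʳ ⅓)) (<-≤-trans gap (≤-diff (s - q + p) (lemma p q s)
        (+-nonneg (0≤diff q≤s) 0≤p))))
        where
        lemma : ∀ p q s → (+ 1 / 3) * s ≡ (q - p - (+ 2 / 3) * s) + (s - q + p)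
        lemma = solve-∀ ℚ-ring

      instance
        s-pos : Positive s
        s-pos = positive 0<s
        s-nonzero : NonZero s
        s-nonzero = pos⇒nonZero s

      r : ℚ
      r = 1/ s

      0≤r : 0ℚ ≤ r
      0≤r = <⇒≤ (positive⁻¹ r {{1/pos⇒pos s}})

      normalised : Bool → Mean (Fin m → Bool)
      normalised true  = record { monotone = scaleᴹ r 0≤r Q ; ap-1 = *-inverseˡ s }
      normalised false = record { monotone = scaleᴹ r 0≤r P ; ap-1 = trans (cong (r *_) mass) (*-inverseˡ s) }

      near : ∀ b → err b (E (normalised b) (χ ∘ G)) ≤ ⅓
      near true = diff≤ (subst (0ℚ ≤_) eq (*-nonneg 0≤r (+-nonneg (<⇒≤ gap) 0≤p)))
        where
        lemma : ∀ r p q s → r * (q - p - (+ 2 / 3) * s + p) ≡ r * q - (+ 2 / 3) * (r * s)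
        lemma = solve-∀ ℚ-ring
        lemma₂ : ∀ t → t - (+ 2 / 3) * 1ℚ ≡ (+ 1 / 3) - (1ℚ - t)
        lemma₂ = solve-∀ ℚ-ring
        eq : r * (q - p - (+ 2 / 3) * s + p) ≡ ⅓ - (1ℚ - r * q)
        eq = trans (lemma r p q s) (trans (cong (λ t → r * q - (+ 2 / 3) * t) (*-inverseˡ s)) (lemma₂ (r * q)))
      near false = diff≤ (subst (0ℚ ≤_) eq (*-nonneg 0≤r (+-nonneg (<⇒≤ gap) (0≤diff q≤s))))
        where
        lemma : ∀ r p q s → r * (q - p - (+ 2 / 3) * s + (s - q)) ≡ (+ 1 / 3) * (r * s) - r * p
        lemma = solve-∀ ℚ-ring
        eq : r * (q - p - (+ 2 / 3) * s + (s - q)) ≡ ⅓ - r * p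
        eq = trans (lemma r p q s) (cong (λ t → t - r * p) (trans (cong (⅓ *_) (*-inverseˡ s)) (*-identityʳ ⅓)))

      dual : Dual G (suc w) ⅓
      dual = record { μ = normalised ; agree = λ S S<w → cong (r *_) (sym (agrees S (ℕ.s≤s⁻¹ S<w))) ; near = near }

    -- A feasible point is the coefficient vector of an approximant, and a refutation is a pair of
    -- measures. Failure at degree at most `w` gives agreement below `suc w`.
    approx⊎dual : Extensional G → ApproxDegAtMost G w ⊎ Dual G (suc w) ⅓
    approx⊎dual G-ext with farkas system
    ... | inj₁ (cs , h) = inj₁ (toPoly low cs , toPoly-deg low cs (All.all-filter low? (cube m)) , approximates)
      where
      at : ∀ {y} → y ∈ cube m → ∣ eval (toPoly low cs) y - χ (G y) ∣ ≤ ⅓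
      at {y} y∈ = bounds⇒∣∣≤ {eval (toPoly low cs) y - χ (G y)}
        (diff≤ (subst (0ℚ ≤_) (trans (cong (λ t → χ (G y) + ⅓ - t) (sym (eval-toPoly low cs y))) (lemma₁ (eval (toPoly low cs) y) (χ (G y)) ⅓))
          (0≤diff (All.lookup h (∈-++⁺ˡ (∈-map⁺ upperAt y∈))))))
        (diff≤ (subst (0ℚ ≤_) (trans (cong (λ t → - 1ℚ * (χ (G y) - ⅓) - t) neg-coords) (lemma₂ (eval (toPoly low cs) y) (χ (G y)) ⅓))
          (0≤diff (All.lookup h (∈-++⁺ʳ (map upperAt (cube m)) (∈-map⁺ lowerAt y∈))))))
        where
        neg-coords : coords low (λ φ → - 1ℚ * φ y) ∙ cs ≡ - 1ℚ * eval (toPoly low cs) y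
        neg-coords = trans (cong (_∙ cs) (sym (coords-⊗ low (- 1ℚ) (λ φ → φ y))))
          (trans (⊗-∙ (- 1ℚ) (coords low (λ φ → φ y)) cs) (cong (- 1ℚ *_) (sym (eval-toPoly low cs y))))
        lemma₁ : ∀ e g t → g + t - e ≡ t - (e - g)
        lemma₁ = solve-∀ ℚ-ring
        lemma₂ : ∀ e g t → - 1ℚ * (g - t) - (- 1ℚ * e) ≡ t - (- (e - g))
        lemma₂ = solve-∀ ℚ-ring
      approximates : Approximates (toPoly low cs) G
      approximates x with ∈-cube x
      ... | y , y∈ , x≗y = subst (_≤ ⅓) (cong₂ (λ a b → ∣ a - χ b ∣) (eval-cong (toPoly low cs) (sym ∘ x≗y)) (G-ext (sym ∘ x≗y))) (at y∈)
    ... | inj₂ (b , b<0 , k) with certify k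
    ...   | P , Q , e , refl = inj₂ (dual P Q agrees b<0)
      where
      agrees : ∀ S → size S ℕ.≤ w → ap P (monoEval S) ≡ ap Q (monoEval S)
      agrees S S≤w with ∈-cube S
      ... | T , T∈ , S≗T = trans (ap-cong P S⇒T) (trans (lemma (ap P (monoEval T)) (ap Q (monoEval T)) T-agrees) (sym (ap-cong Q S⇒T)))
        where
        S⇒T : monoEval S ≗ monoEval T
        S⇒T x = monoEval-cong S≗T (λ _ → refl)
        T-agrees = All.lookup (coords-𝟎 low _ e) (∈-filter⁺ low? T∈ (subst (ℕ._≤ w) (size-cong S≗T) S≤w))
        ring : ∀ a b → a ≡ a - b + b
        ring = solve-∀ ℚ-ring
        lemma : ∀ a b → 0ℚ ≡ a - b → a ≡ b
        lemma a b d = trans (ring a b) (trans (cong (_+ b) (sym d)) (+-identityˡ b))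

-- Error reduction through levels of the base function, and degree bounds for one composition.

module Composition where

  open import Defs
  open import Data.Bool using (Bool; true; false)
  open import Data.Empty using (⊥-elim)
  open import Data.Fin using (Fin; zero; suc; combine)
  open import Data.Integer using (+_)
  open import Data.Nat as ℕ using (ℕ; zero; suc)
  import Data.Nat.DivMod as ℕ
  import Data.Nat.Properties as ℕ
  open import Data.Nat.Tactic.RingSolver using () renaming (solve-∀ to ℕ-solve-∀)
  open import Data.Product using (Σ; _×_; _,_; proj₁; proj₂)
  open import Data.Rational
  open import Data.Rational.Properties
  open import Function using (_∘_)
  open import Relation.Binary.PropositionalEquality
  open import Relation.Nullary using (yes; no)
  open import Tactic.RingSolver using (solve-∀)
  open Rationals
  open Degree
  open Means
  open Duality using (Dual)

  open Mean renaming (ap to E)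
  open Dual

  Dual-weaken : ∀ {m} {G : BoolFn m} {w c d} → c ≤ d → Dual G w c → Dual G w d
  Dual-weaken c≤d D = record { μ = μ D ; agree = agree D ; near = λ b → ≤-trans (near D b) c≤d }

  err-level : ∀ {q p c} → (∀ v → err v q ≤ andOrBias (err v p)) → InUnit p → c ≤ 1ℚ → ∀ v → err v p ≤ c → err v q ≤ andOrBias c
  err-level h u c≤1 v e = ≤-trans (h v) (andOr-mono (proj₁ (err-unit v u)) c≤1 e)

  -- The ring identities evaluate the multilinear extension at equal biases; for majority,
  -- self-duality and `maj≤andOr` finish.
  err-fn : ∀ b v p → err v (multilinear (χ ∘ fn b) (λ _ → p)) ≤ andOrBias (err v p)
  err-fn maj₃ v p = subst (_≤ andOrBias (err v p)) (trans (sym (err-maj v p)) (cong (err v) (sym (lemma p)))) (maj≤andOr (err v p))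
    where
    lemma : ∀ p →
      p * (p * (p * 1ℚ + (1ℚ - p) * 1ℚ) + (1ℚ - p) * (p * 1ℚ + (1ℚ - p) * 0ℚ)) +
      (1ℚ - p) * (p * (p * 1ℚ + (1ℚ - p) * 0ℚ) + (1ℚ - p) * (p * 0ℚ + (1ℚ - p) * 0ℚ))
      ≡ p * p * ((+ 3 / 1) - (+ 2 / 1) * p)
    lemma = solve-∀ ℚ-ring
  err-fn andOr v p = subst (_≤ andOrBias (err v p)) (cong (err v) (sym (trans (lemma p (either p)) (cong (p * (2ℚ - p) *_) (or p))))) (err-andOr v p)
    where
    either : ℚ → ℚ
    either p = p * (p * 1ℚ + (1ℚ - p) * 1ℚ) + (1ℚ - p) * (p * 1ℚ + (1ℚ - p) * 0ℚ)
    or : ∀ p → p * (p * 1ℚ + (1ℚ - p) * 1ℚ) + (1ℚ - p) * (p * 1ℚ + (1ℚ - p) * 0ℚ) ≡ p * ((+ 2 / 1) - p)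
    or = solve-∀ ℚ-ring
    lemma : ∀ p t →
      p * (p * t + (1ℚ - p) * t) +
      (1ℚ - p) * (p * t + (1ℚ - p) * (p * (p * 0ℚ + (1ℚ - p) * 0ℚ) + (1ℚ - p) * (p * 0ℚ + (1ℚ - p) * 0ℚ)))
      ≡ p * ((+ 2 / 1) - p) * t
    lemma = solve-∀ ℚ-ring

  fn-ext : ∀ b → Extensional (fn b)
  fn-ext maj₃  e rewrite e zero | e (suc zero) | e (suc (suc zero)) = refl
  fn-ext andOr e rewrite e zero | e (suc zero) | e (suc (suc zero)) | e (suc (suc (suc zero))) = refl

  ⊚-ext : ∀ {n m} {f : BoolFn n} {g : BoolFn m} → Extensional f → Extensional g → Extensional (f ⊚ g)
  ⊚-ext f-ext g-ext e = f-ext λ i → g-ext λ j → e (combine i j)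

  ≤-sum : ∀ {n} (d : Fin n → ℕ) i → d i ℕ.≤ sum d
  ≤-sum d zero    = ℕ.m≤m+n (d zero) _
  ≤-sum d (suc i) = ℕ.≤-trans (≤-sum (d ∘ suc) i) (ℕ.m≤n+m _ (d zero))

  -- A monomial of size below `w` has size below `w` in every block, so its two expectations agree
  -- factor by factor.
  dual-level : ∀ b {m} {G : BoolFn m} {w c} → Extensional G → c ≤ 1ℚ → Dual G w c → Dual (fn b ⊚ G) w (andOrBias c)
  dual-level b {m} {G} {w} {c} G-ext c≤1 D = record
    { μ     = λ v → blocks {arity b} (λ _ → μ D v)
    ; agree = λ S S<w → trans (ap-blocks-mono {arity b} (λ _ → μ D true) S)
        (trans (∏-cong (λ i → agree D _ (ℕ.≤-<-trans
            (ℕ.≤-trans (≤-sum (λ i → size (S ∘ combine {arity b} i)) i) (ℕ.≤-reflexive (sym (size-combine (arity b) S)))) S<w)))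
          (sym (ap-blocks-mono {arity b} (λ _ → μ D false) S)))
    ; near  = λ v → subst (λ q → err v q ≤ andOrBias c) (sym (ap-blocks-⊚ (λ _ → μ D v) (fn b) G (fn-ext b) G-ext))
        (err-level {multilinear (χ ∘ fn b) (λ _ → E (μ D v) (χ ∘ G))} (λ u → err-fn b u (E (μ D v) (χ ∘ G)))
          (ap-unit (μ D v) (χ-unit ∘ G)) c≤1 v (near D v))
    }

  ½^_ : ℕ → ℚ
  ½^ zero  = 1ℚ
  ½^ suc L = ½ * ½^ L

  ½^-+ : ∀ L M → ½^ (L ℕ.+ M) ≡ ½^ L * ½^ M
  ½^-+ zero    M = sym (*-identityˡ (½^ M))
  ½^-+ (suc L) M = trans (cong (½ *_) (½^-+ L M)) (sym (*-assoc ½ (½^ L) (½^ M)))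

  ½^-unit : ∀ L → InUnit (½^ L)
  ½^-unit zero    = ≤ᵇ⇒≤ _ , ≤-refl
  ½^-unit (suc L) with ½^-unit L
  ... | 0≤h , h≤1 = *-nonneg {½} (≤ᵇ⇒≤ _) 0≤h , ≤-trans (*-≤ʳ {½} (≤ᵇ⇒≤ _) 0≤h) h≤1

  -- Upper bounds for the orbit of 1/3 under andOrBias. It leaves the fixed point (3 - √5)/2 slowly, and
  -- squares its error at every step once it is below 1/8.
  orbit : ℕ → ℚ
  orbit 0 = + 1 / 3
  orbit 1 = + 31 / 100
  orbit 2 = + 7 / 25
  orbit 3 = + 6 / 25
  orbit 4 = + 9 / 50
  orbit (suc (suc (suc (suc (suc j))))) = + 1 / 4 * ½^ (2 ℕ.^ j)

  orbit-unit : ∀ j → InUnit (orbit j)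
  orbit-unit 0 = ≤ᵇ⇒≤ _ , ≤ᵇ⇒≤ _
  orbit-unit 1 = ≤ᵇ⇒≤ _ , ≤ᵇ⇒≤ _
  orbit-unit 2 = ≤ᵇ⇒≤ _ , ≤ᵇ⇒≤ _
  orbit-unit 3 = ≤ᵇ⇒≤ _ , ≤ᵇ⇒≤ _
  orbit-unit 4 = ≤ᵇ⇒≤ _ , ≤ᵇ⇒≤ _
  orbit-unit (suc (suc (suc (suc (suc j))))) with ½^-unit (2 ℕ.^ j)
  ... | 0≤h , h≤1 = *-nonneg {+ 1 / 4} (≤ᵇ⇒≤ _) 0≤h , ≤-trans (*-≤ʳ {+ 1 / 4} (≤ᵇ⇒≤ _) 0≤h) h≤1

  orbit-step : ∀ j → andOrBias (orbit j) ≤ orbit (suc j)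
  orbit-step 0 = ≤ᵇ⇒≤ _
  orbit-step 1 = ≤ᵇ⇒≤ _
  orbit-step 2 = ≤ᵇ⇒≤ _
  orbit-step 3 = ≤ᵇ⇒≤ _
  orbit-step 4 = ≤ᵇ⇒≤ _
  -- For an error h/4 the bound 4(h/4)² equals h²/4, and squaring h doubles its exponent.
  orbit-step (suc (suc (suc (suc (suc j))))) =
    ≤-trans (andOr≤4sq (orbit-unit (5 ℕ.+ j))) (≤-reflexive (trans (lemma h) (cong (+ 1 / 4 *_) doubled)))
    where
    h : ℚ
    h = ½^ (2 ℕ.^ j)
    lemma : ∀ h → + 4 / 1 * (+ 1 / 4 * h * (+ 1 / 4 * h)) ≡ + 1 / 4 * (h * h)
    lemma = solve-∀ ℚ-ring
    doubled : h * h ≡ ½^ (2 ℕ.^ suc j)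
    doubled = trans (sym (½^-+ (2 ℕ.^ j) (2 ℕ.^ j))) (cong (λ L → ½^ (2 ℕ.^ j ℕ.+ L)) (sym (ℕ.+-identityʳ (2 ℕ.^ j))))

  dual-step : ∀ b {m} {G : BoolFn m} {w} j → Extensional G → Dual G w (orbit j) → Dual (fn b ⊚ G) w (orbit (suc j))
  dual-step b j G-ext D = Dual-weaken (orbit-step j) (dual-level b G-ext (proj₂ (orbit-unit j)) D)

  ·-+ : ∀ m n c → (m ℕ.+ n) · c ≡ m · c + n · c
  ·-+ zero    n c = sym (+-identityˡ (n · c))
  ·-+ (suc m) n c = trans (cong (λ s → c + s) (·-+ m n c)) (sym (+-assoc c (m · c) (n · c)))

  ·-* : ∀ n c d → n · (c * d) ≡ c * (n · d)
  ·-* zero    c d = sym (*-zeroʳ c)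
  ·-* (suc n) c d = trans (cong (λ s → c * d + s) (·-* n c d)) (sym (*-distribˡ-+ c d (n · d)))

  ·-nonneg : ∀ n {c} → 0ℚ ≤ c → 0ℚ ≤ n · c
  ·-nonneg zero    0≤c = ≤-refl
  ·-nonneg (suc n) 0≤c = +-nonneg 0≤c (·-nonneg n 0≤c)

  ·-mono : ∀ {m n c} → m ℕ.≤ n → 0ℚ ≤ c → m · c ≤ n · c
  ·-mono {n = n} ℕ.z≤n   0≤c = ·-nonneg n 0≤c
  ·-mono {c = c} (ℕ.s≤s m≤n) 0≤c = +-monoʳ-≤ c (·-mono m≤n 0≤c)

  2^·½^ : ∀ L → (2 ℕ.^ L) · (½^ L) ≡ 1ℚ
  2^·½^ zero    = refl
  2^·½^ (suc L) = trans (·-* (2 ℕ.* 2 ℕ.^ L) ½ (½^ L)) (trans (cong (½ *_)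
    (trans (·-+ (2 ℕ.^ L) (2 ℕ.^ L ℕ.+ 0) (½^ L)) (cong₂ _+_ (2^·½^ L)
      (trans (cong (_· (½^ L)) (ℕ.+-identityʳ (2 ℕ.^ L))) (2^·½^ L))))) refl)

  -- The 1/4 for all blocks together and the 1/12 of a boosted approximant add up to 1/3.
  union-bound : ∀ {n} s → n ℕ.≤ 2 ℕ.^ (2 ℕ.^ s) → n · orbit (5 ℕ.+ s) ≤ + 1 / 4
  union-bound {n} s n≤ = subst (_≤ + 1 / 4) (sym (·-* n (+ 1 / 4) (½^ (2 ℕ.^ s))))
    (*-≤ˡ {+ 1 / 4} (≤ᵇ⇒≤ _) (subst (n · (½^ (2 ℕ.^ s)) ≤_) (2^·½^ (2 ℕ.^ s)) (·-mono n≤ (proj₁ (½^-unit (2 ℕ.^ s))))))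

  -- The degree of `boost` is 243 = 3^5, and 2^10 is a power of two above 4 * 243, which bounds the
  -- growth per level. Abstraction keeps the numerals from being unfolded.
  abstract
    boost-deg : ℕ
    boost-deg = 243

    boost-deg≢0 : ℕ.NonZero boost-deg
    boost-deg≢0 = _

    boost-exp : ℕ
    boost-exp = 10

    4*boost-deg≤2^boost-exp : 4 ℕ.* boost-deg ℕ.≤ 2 ℕ.^ boost-exp
    4*boost-deg≤2^boost-exp = ℕ.≤ᵇ⇒≤ 972 1024 _

    3^5*≤boost-deg* : ∀ r → 3 ℕ.* (3 ℕ.* (3 ℕ.* (3 ℕ.* (3 ℕ.* r)))) ℕ.≤ boost-deg ℕ.* r
    3^5*≤boost-deg* r = ℕ.≤-reflexive (collect r)
      where
      collect : ∀ r → 3 ℕ.* (3 ℕ.* (3 ℕ.* (3 ℕ.* (3 ℕ.* r)))) ≡ 243 ℕ.* r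
      collect = ℕ-solve-∀

  deg-boost : ∀ {n r} {φ : (Fin n → Bool) → ℚ} → HasDeg r φ → HasDeg (boost-deg ℕ.* r) (boost ∘ φ)
  deg-boost {r = r} h = deg-weaken (3^5*≤boost-deg* r) (deg-maj (deg-maj (deg-maj (deg-maj (deg-maj
    (deg-+ (deg-scale (+ 3 / 5) h) (deg-weaken ℕ.z≤n (deg-const (+ 1 / 5)))))))))

  apart : ∀ v {A : Set} → ∣ v - 1ℚ ∣ ≤ + 1 / 3 → ∣ v - 0ℚ ∣ ≤ + 1 / 3 → A
  apart v a b = ⊥-elim (≤⇒≤ᵇ {1ℚ} {+ 2 / 3} (subst (_≤ + 2 / 3) (lemma v) (+-mono-≤ (proj₂ (∣∣≤⇒bounds {v - 1ℚ} a)) (proj₁ (∣∣≤⇒bounds {v - 0ℚ} b)))))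
    where
    lemma : ∀ v → - (v - 1ℚ) + (v - 0ℚ) ≡ 1ℚ
    lemma = solve-∀ ℚ-ring

  -- Polynomials respect pointwise equality, and a value within 1/3 of a bit determines it.
  approx-ext : ∀ {n k} {f : BoolFn n} → ApproxDegAtMost f k → Extensional f
  approx-ext {f = f} (p , _ , h) {x} {y} e
    with f x | f y | h x | subst (λ v → ∣ v - χ (f y) ∣ ≤ + 1 / 3) (sym (eval-cong p e)) (h y)
  ... | true  | true  | _  | _  = refl
  ... | false | false | _  | _  = refl
  ... | true  | false | hx | hy = apart (eval p x) hx hy
  ... | false | true  | hx | hy = apart (eval p x) hy hx

  approx : ∀ {n D} {f : BoolFn n} {φ : (Fin n → Bool) → ℚ} → HasDeg D φ → (∀ x → Close (+ 1 / 3) (f x) (φ x)) → ApproxDegAtMost f D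
  approx {f = f} (p , d , v) h = p , d , λ x → subst (λ y → ∣ y - χ (f x) ∣ ≤ + 1 / 3) (sym (v x)) (close⇒near (≤ᵇ⇒≤ _) (h x))

  arity≤4 : ∀ b → arity b ℕ.≤ 4
  arity≤4 maj₃  = ℕ.n≤1+n 3
  arity≤4 andOr = ℕ.≤-refl

  -- The multilinear extension of the base function is applied to boosted approximants of its at
  -- most four arguments; the total error is at most 4/12.
  approx-upper : ∀ b {m r} {G : BoolFn m} → ApproxDegAtMost G r → ApproxDegAtMost (fn b ⊚ G) (arity b ℕ.* (boost-deg ℕ.* r))
  approx-upper b {m} {G = G} (p , d , h) = approx {f = fn b ⊚ G}
    (deg-multilinear (χ ∘ fn b) (λ i → deg-reindex (combine i) (deg-boost (p , d , λ _ → refl))))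
    (λ x → close-weaken (≤-trans (·-mono (arity≤4 b) (≤ᵇ⇒≤ {0ℚ} {+ 1 / 12} _)) (≤ᵇ⇒≤ _))
      (multilinear-close {v = (fn b ⊚ G) x} {b = λ i → G (x ∘ combine i)} (cong χ ∘ fn-ext b) (χ-unit ∘ fn b) (λ i → close-boost (eval p (x ∘ combine i)) (h (x ∘ combine i))) refl))

  ap-err : ∀ {X} (M : Mean X) v (φ : X → ℚ) → E M (err v ∘ φ) ≡ err v (E M φ)
  ap-err M false φ = refl
  ap-err M true  φ = trans (ap-cong M (λ x → lemma (φ x))) (trans (ap-affine M (- 1ℚ) 1ℚ φ) (sym (lemma (E M φ))))
    where
    lemma : ∀ a → 1ℚ - a ≡ - 1ℚ * a + 1ℚ
    lemma = solve-∀ ℚ-ring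

  sum-* : ∀ {n} (d : Fin n → ℕ) w → sum d ℕ.* w ≡ sum (λ i → d i ℕ.* w)
  sum-* {zero}  d w = refl
  sum-* {suc n} d w = trans (ℕ.*-distribʳ-+ w (d zero) (sum (d ∘ suc))) (cong (d zero ℕ.* w ℕ.+_) (sum-* (d ∘ suc) w))

  sum-mono : ∀ {n} {d e : Fin n → ℕ} → (∀ i → d i ℕ.≤ e i) → sum d ℕ.≤ sum e
  sum-mono {zero}  h = ℕ.z≤n
  sum-mono {suc n} h = ℕ.+-mono-≤ (h zero) (sum-mono (h ∘ suc))

  -- Averaging an approximant of f ∘ H over the inputs with H-values distributed as prescribed by z leaves
  -- a polynomial in z. A monomial loses its dependence on zᵢ unless it has degree at least w in block i.
  compose-lower : ∀ {n m r w c} {f : BoolFn n} {H : BoolFn m} .{{_ : ℕ.NonZero w}} → Extensional f → Extensional H →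
    Dual H w c → n · c ≤ + 1 / 4 → ApproxDegAtMost (f ⊚ H) r → ApproxDegAtMost f (boost-deg ℕ.* r ℕ./ w)
  compose-lower {n} {m} {r} {w} {c} {f} {H} f-ext H-ext D nc≤ (p , d , h) =
    approx (deg-linear (λ z → linear (M z)) degree (deg-boost (p , d , λ _ → refl))) accuracy
    where
    M : (Fin n → Bool) → Mean (Fin (n ℕ.* m) → Bool)
    M z = blocks (λ i → μ D (z i))

    block-deg : ∀ (S : Fin m → Bool) i → Σ ℕ λ e → e ℕ.* w ℕ.≤ size S × HasDeg {n} e (λ z → E (μ D (z i)) (monoEval S))
    block-deg S i with size S ℕ.<? w
    ... | yes S<w = 0 , ℕ.z≤n , deg-cong (λ z → constant (z i)) (deg-const (E (μ D false) (monoEval S)))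
      where
      constant : ∀ v → E (μ D false) (monoEval S) ≡ E (μ D v) (monoEval S)
      constant true  = sym (agree D S S<w)
      constant false = refl
    ... | no S≮w = 1 , ℕ.≤-trans (ℕ.≤-reflexive (ℕ.*-identityˡ w)) (ℕ.≮⇒≥ S≮w) ,
      deg-cong (λ z → affine (z i)) (deg-+ (deg-scale (E (μ D true) (monoEval S) - E (μ D false) (monoEval S)) (deg-var i))
        (deg-weaken ℕ.z≤n (deg-const (E (μ D false) (monoEval S)))))
      where
      at-1 : ∀ s t → (s - t) * 1ℚ + t ≡ s
      at-1 = solve-∀ ℚ-ring
      at-0 : ∀ s t → (s - t) * 0ℚ + t ≡ t
      at-0 = solve-∀ ℚ-ring
      affine : ∀ v → (E (μ D true) (monoEval S) - E (μ D false) (monoEval S)) * χ v + E (μ D false) (monoEval S) ≡ E (μ D v) (monoEval S)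
      affine true  = at-1 _ _
      affine false = at-0 (E (μ D true) (monoEval S)) _

    degree : ∀ S → size S ℕ.≤ boost-deg ℕ.* r → HasDeg (boost-deg ℕ.* r ℕ./ w) (λ z → E (M z) (monoEval S))
    degree S S≤ = deg-cong (λ z → sym (ap-blocks-mono (λ i → μ D (z i)) S))
      (deg-weaken bound′ (deg-∏ e (λ i → proj₂ (proj₂ (block-deg (S ∘ combine {n} i) i)))))
      where
      e : Fin n → ℕ
      e i = proj₁ (block-deg (S ∘ combine {n} i) i)
      e*w≤ : sum e ℕ.* w ℕ.≤ boost-deg ℕ.* r
      e*w≤ = ℕ.≤-trans (ℕ.≤-reflexive (sum-* e w)) (ℕ.≤-trans
        (sum-mono (λ i → proj₁ (proj₂ (block-deg (S ∘ combine {n} i) i))))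
        (ℕ.≤-trans (ℕ.≤-reflexive (sym (size-combine n S))) S≤))
      bound′ : sum e ℕ.≤ boost-deg ℕ.* r ℕ./ w
      bound′ = subst (ℕ._≤ boost-deg ℕ.* r ℕ./ w) (ℕ.m*n/n≡m (sum e) w) (ℕ./-monoˡ-≤ w e*w≤)

    -- If `u` differs from `v`, the right side exceeds 1, while boosted values lie in [0,1].
    pointwise : ∀ v u {y} → Close (+ 1 / 12) u y → err v y ≤ + 1 / 12 + err v (χ u)
    pointwise true  true  {y} k = subst (1ℚ - y ≤_) (sym (+-identityʳ (+ 1 / 12))) (bound k)
    pointwise false false {y} k = subst (y ≤_) (sym (+-identityʳ (+ 1 / 12))) (bound k)
    pointwise true  false k = ≤-trans (proj₂ (err-unit true (unit k))) (≤ᵇ⇒≤ _)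
    pointwise false true  k = ≤-trans (proj₂ (unit k)) (≤ᵇ⇒≤ _)

    accuracy : ∀ z → Close (+ 1 / 3) (f z) (E (M z) (boost ∘ eval p))
    accuracy z = close (ap-unit (M z) (λ x → unit (boosted x)))
      (subst (_≤ + 1 / 3) (ap-err (M z) v (boost ∘ eval p))
        (≤-trans (ap-mono (M z) (λ x → pointwise v ((f ⊚ H) x) (boosted x)))
          (≤-trans (≤-reflexive (trans (ap-+ (M z) (λ _ → + 1 / 12) (err v ∘ χ ∘ (f ⊚ H)))
              (cong₂ _+_ (ap-const (M z) (+ 1 / 12)) (ap-err (M z) v (χ ∘ (f ⊚ H))))))
            (+-monoʳ-≤ (+ 1 / 12) (≤-trans mismatch nc≤)))))
      where
      v : Bool
      v = f z
      boosted : ∀ x → Close (+ 1 / 12) ((f ⊚ H) x) (boost (eval p x))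
      boosted x = close-boost (eval p x) (h x)
      -- Block i has an `H`-value other than `z i` with probability at most `c`.
      mismatch : err v (E (M z) (χ ∘ (f ⊚ H))) ≤ n · c
      mismatch = subst (λ q → err v q ≤ n · c) (sym (ap-blocks-⊚ (λ i → μ D (z i)) f H f-ext H-ext))
        (bound (multilinear-close {v = v} (cong χ ∘ f-ext) (χ-unit ∘ f)
          (λ i → close (ap-unit (μ D (z i)) (χ-unit ∘ H)) (near D (z i))) refl))

open import Defs
open import Data.Bool using (Bool; true; false)
open import Data.Fin using (Fin; zero; suc; combine; remQuot)
open import Data.Fin.Properties using (remQuot-combine)
import Data.Integer as ℤ
import Data.List.Relation.Unary.All as All
open import Data.Nat as ℕ using (ℕ; zero; suc; _+_; _*_; _^_; _≤_; _<_; _/_; z≤n; s≤s; ⌈_/2⌉)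
import Data.Nat.DivMod as ℕ
open import Data.Nat.Induction using (<-wellFounded)
open import Data.Nat.Logarithm
open import Data.Nat.Properties
open import Data.Nat.Tactic.RingSolver using (solve-∀)
open import Data.Product using (_×_; _,_; ∃; ∃-syntax; proj₁; proj₂; uncurry)
import Data.Rational as ℚ
import Data.Rational.Properties as ℚ
open import Data.Sum using (_⊎_; inj₁; inj₂)
open import Function using (_∘_; _$_)
open import Induction.WellFounded using (Acc; acc)
open import Relation.Binary.PropositionalEquality
open import Relation.Nullary using (yes; no; contradiction)
open Degree
open Means using (deg-multilinear; multilinear-χ)
open Rationals using (close; χ-unit; err-χ)
open Duality using (Dual; approx⊎dual)
open Composition

-- Composition up to renaming of variables.

infix 4 _≼_

-- The two bracketings of a triple composition have different index types, so a relation stands in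
-- for equality. Renamings may identify variables, and approximants pass from left to right.
record _≼_ {n m} (F : BoolFn n) (F′ : BoolFn m) : Set where
  constructor via
  field
    rename : Fin n → Fin m
    agrees : ∀ y → F (y ∘ rename) ≡ F′ y

≼-trans : ∀ {n m l} {F : BoolFn n} {G : BoolFn m} {H : BoolFn l} → F ≼ G → G ≼ H → F ≼ H
≼-trans (via σ p) (via τ q) = via (τ ∘ σ) λ y → trans (p (y ∘ τ)) (q y)

approx-≼ : ∀ {n m k} {F : BoolFn n} {F′ : BoolFn m} → F ≼ F′ → ApproxDegAtMost F k → ApproxDegAtMost F′ k
approx-≼ (via τ e) (p , d , h) with deg-reindex τ (p , d , λ _ → refl)
... | q , dq , v = q , dq , λ y → subst₂ (λ a b → ℚ.∣ a ℚ.- χ b ∣ ℚ.≤ ℤ.+ 1 ℚ./ 3) (sym (v y)) (e y) (h (y ∘ τ))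

⊚-monoʳ : ∀ {k n m} {h : BoolFn k} {F : BoolFn n} {F′ : BoolFn m} → Extensional h → Extensional F → F ≼ F′ → h ⊚ F ≼ h ⊚ F′
⊚-monoʳ {k} {n} {m} h-ext F-ext (via τ e) = via τ′ λ y → h-ext λ i →
  trans (F-ext λ j → cong (λ (i , j) → y (combine i (τ j))) (remQuot-combine i j)) (e (y ∘ combine i))
  where
  τ′ : Fin (k * n) → Fin (k * m)
  τ′ c = uncurry (λ i j → combine i (τ j)) (remQuot {k} n c)

⊚-assocˡ : ∀ {k n m} {h : BoolFn k} {F : BoolFn n} {G : BoolFn m} → Extensional h → Extensional F → Extensional G →
  (h ⊚ F) ⊚ G ≼ h ⊚ (F ⊚ G)
⊚-assocˡ {k} {n} {m} h-ext F-ext G-ext = via τ λ y → h-ext λ i → F-ext λ i′ → G-ext λ j → cong y $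
  trans (cong (λ (c , j) → left c j) (remQuot-combine (combine i i′) j))
        (cong (λ (i , i′) → combine i (combine i′ j)) (remQuot-combine i i′))
  where
  left : Fin (k * n) → Fin m → Fin (k * (n * m))
  left c j = uncurry (λ i i′ → combine i (combine i′ j)) (remQuot {k} n c)
  τ : Fin (k * n * m) → Fin (k * (n * m))
  τ c = uncurry left (remQuot {k * n} m c)

⊚-assocʳ : ∀ {k n m} {h : BoolFn k} {F : BoolFn n} {G : BoolFn m} → Extensional h → Extensional F → Extensional G →
  h ⊚ (F ⊚ G) ≼ (h ⊚ F) ⊚ G
⊚-assocʳ {k} {n} {m} h-ext F-ext G-ext = via τ λ y → h-ext λ i → F-ext λ i′ → G-ext λ j → cong y $
  trans (cong (λ (i , c) → right i c) (remQuot-combine i (combine i′ j)))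
        (cong (λ (i′ , j) → combine (combine i i′) j) (remQuot-combine i′ j))
  where
  right : Fin k → Fin (n * m) → Fin (k * n * m)
  right i c = uncurry (λ i′ j → combine (combine i i′) j) (remQuot {n} m c)
  τ : Fin (k * (n * m)) → Fin (k * n * m)
  τ c = uncurry right (remQuot {k} (n * m) c)

fn-idem : ∀ b u → fn b (λ _ → u) ≡ u
fn-idem maj₃  true  = refl
fn-idem maj₃  false = refl
fn-idem andOr true  = refl
fn-idem andOr false = refl

module _ (b : Base) where

  h : BoolFn (arity b)
  h = fn b

  h-ext : Extensional h
  h-ext = fn-ext b

  ^^-ext : ∀ d → Extensional (h ^^ d)
  ^^-ext zero    e = e zero
  ^^-ext (suc d)   = ⊚-ext h-ext (^^-ext d)

  ^^-idem : ∀ d {x u} → (∀ i → x i ≡ u) → (h ^^ d) x ≡ u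
  ^^-idem zero    e = e zero
  ^^-idem (suc d) {u = u} e = trans (h-ext λ i → ^^-idem d λ j → e (combine i j)) (fn-idem b u)

  -- All variables of a block are identified, and `h ^^ d` returns the common value.
  ⊚-^^-≼ : ∀ {n} {f : BoolFn n} d → Extensional f → f ⊚ (h ^^ d) ≼ f
  ⊚-^^-≼ d f-ext = via (proj₁ ∘ remQuot _) λ y → f-ext λ i → ^^-idem d λ j → cong (y ∘ proj₁) (remQuot-combine i j)

  -- All copies of `g` receive the same input.
  ^^-⊚-≼ : ∀ {m} {g : BoolFn m} d → Extensional g → (h ^^ d) ⊚ g ≼ g
  ^^-⊚-≼ d g-ext = via (proj₂ ∘ remQuot {arity b ^ d} _) λ y → ^^-idem d λ i → g-ext λ j → cong (y ∘ proj₂) (remQuot-combine i j)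

  ≼-^^0-⊚ : ∀ {m} (G : BoolFn m) → G ≼ (h ^^ 0) ⊚ G
  ≼-^^0-⊚ G = via (combine {1} zero) λ _ → refl

  ^^-+ : ∀ d j → (h ^^ d) ⊚ (h ^^ j) ≼ h ^^ (d + j)
  ^^-+ zero    j = ^^-⊚-≼ 0 (^^-ext j)
  ^^-+ (suc d) j = ≼-trans (⊚-assocˡ h-ext (^^-ext d) (^^-ext j))
    (⊚-monoʳ h-ext (⊚-ext (^^-ext d) (^^-ext j)) (^^-+ d j))

  -- The arity of h^j ∘ g bracketed to the right, so that each level is literally `h` composed with
  -- the function below.
  towerArity : ℕ → ℕ → ℕ
  towerArity zero    m = m
  towerArity (suc j) m = arity b * towerArity j m

  tower : ∀ j {m} → BoolFn m → BoolFn (towerArity j m)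
  tower zero    g = g
  tower (suc j) g = h ⊚ tower j g

  tower-ext : ∀ j {m} {g : BoolFn m} → Extensional g → Extensional (tower j g)
  tower-ext zero    g-ext = g-ext
  tower-ext (suc j) g-ext = ⊚-ext h-ext (tower-ext j g-ext)

  ^^-⊚-tower : ∀ j {m} {g : BoolFn m} → Extensional g → (h ^^ j) ⊚ g ≼ tower j g
  ^^-⊚-tower zero    g-ext = ^^-⊚-≼ 0 g-ext
  ^^-⊚-tower (suc j) g-ext = ≼-trans (⊚-assocˡ h-ext (^^-ext j) g-ext)
    (⊚-monoʳ h-ext (⊚-ext (^^-ext j) g-ext) (^^-⊚-tower j g-ext))

  ^^-+-⊚ : ∀ d j {m} {g : BoolFn m} → Extensional g → (h ^^ (d + j)) ⊚ g ≼ (h ^^ d) ⊚ tower j g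
  ^^-+-⊚ zero    j {g = g} g-ext = ≼-trans (^^-⊚-tower j g-ext) (≼-^^0-⊚ (tower j g))
  ^^-+-⊚ (suc d) j g-ext = ≼-trans (⊚-assocˡ h-ext (^^-ext (d + j)) g-ext)
    (≼-trans (⊚-monoʳ h-ext (⊚-ext (^^-ext (d + j)) g-ext) (^^-+-⊚ d j g-ext))
      (⊚-assocʳ h-ext (^^-ext d) (tower-ext j g-ext)))

  dual-^^ : ∀ j {d w} → Dual (h ^^ d) w (orbit 0) → Dual (h ^^ (j + d)) w (orbit j)
  dual-^^ zero    D = D
  dual-^^ (suc j) {d} D = dual-step b j (^^-ext (j + d)) (dual-^^ j D)

  dual-tower : ∀ j {m w} {g : BoolFn m} → Extensional g → Dual g w (orbit 0) → Dual (tower j g) w (orbit j)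
  dual-tower zero    g-ext D = D
  dual-tower (suc j) g-ext D = dual-step b j (tower-ext j g-ext) (dual-tower j g-ext D)

-- Logarithms and the polylogarithmic overhead.

n≤2^⌈log₂n⌉ : ∀ n → n ≤ 2 ^ ⌈log₂ n ⌉
n≤2^⌈log₂n⌉ n = go n (<-wellFounded n)
  where
  go : ∀ n → Acc _<_ n → n ≤ 2 ^ ⌈log₂ n ⌉
  go 0 _ = z≤n
  go 1 _ = s≤s z≤n
  go n@(suc (suc k)) (acc rec) = begin
    n                        ≡⟨ sym (⌊n/2⌋+⌈n/2⌉≡n n) ⟩
    ℕ.⌊ n /2⌋ + ⌈ n /2⌉      ≤⟨ +-monoˡ-≤ ⌈ n /2⌉ (⌊n/2⌋≤⌈n/2⌉ n) ⟩
    ⌈ n /2⌉ + ⌈ n /2⌉        ≡⟨ cong (⌈ n /2⌉ +_) (sym (+-identityʳ ⌈ n /2⌉)) ⟩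
    2 * ⌈ n /2⌉              ≤⟨ *-monoʳ-≤ 2 (go ⌈ n /2⌉ (rec (⌈n/2⌉<n k))) ⟩
    2 ^ suc ⌈log₂ ⌈ n /2⌉ ⌉  ≡⟨ cong (λ l → 2 ^ suc l) (⌈log₂⌈n/2⌉⌉≡⌈log₂n⌉∸1 n) ⟩
    2 ^ suc (ℕ.pred ⌈log₂ n ⌉) ≡⟨ cong (2 ^_) (suc-pred ⌈log₂ n ⌉ {{ℕ.>-nonZero (⌈log₂⌉-mono-≤ (s≤s (s≤s (z≤n {k}))))}}) ⟩
    2 ^ ⌈log₂ n ⌉            ∎
    where open ≤-Reasoning

-- The summand 1 makes the bound hold at 0 as well.
2^⌈log₂n⌉≤2[1+n] : ∀ n → 2 ^ ⌈log₂ n ⌉ ≤ 2 * (1 + n)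
2^⌈log₂n⌉≤2[1+n] n with ⌈log₂ n ⌉ in eq
... | zero  = s≤s z≤n
... | suc l with 2 ^ l ≤? suc n
...   | yes le = *-monoʳ-≤ 2 le
...   | no ¬le = contradiction (subst (_≤ l) eq (subst (⌈log₂ n ⌉ ≤_) (⌈log₂2^n⌉≡n l) (⌈log₂⌉-mono-≤ (≤-trans (n≤1+n n) (<⇒≤ (≰⇒> ¬le)))))) 1+n≰n

^-distribʳ-* : ∀ o m n → (m * n) ^ o ≡ m ^ o * n ^ o
^-distribʳ-* zero    m n = refl
^-distribʳ-* (suc o) m n = trans (cong (m * n *_) (^-distribʳ-* o m n)) (swap m n (m ^ o) (n ^ o))
  where
  swap : ∀ a b c d → a * b * (c * d) ≡ a * c * (b * d)
  swap = solve-∀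

loglog : ℕ → ℕ
loglog n = ⌈log₂ ⌈log₂ n ⌉ ⌉

n≤2^2^loglog : ∀ n → n ≤ 2 ^ (2 ^ loglog n)
n≤2^2^loglog n = ≤-trans (n≤2^⌈log₂n⌉ n) (^-monoʳ-≤ 2 (n≤2^⌈log₂n⌉ ⌈log₂ n ⌉))

-- The price in degree of the levels that push the error below 1/(4n), at a factor `β` per level.
overhead : ℕ → ℕ → ℕ
overhead β n = β ^ (5 + loglog n)

-- Exchanging exponents turns β^(loglog n) into the `i`-th power of 2^(loglog n), which is at most
-- twice 1 + log n.
overhead-polylog : ∀ i n → overhead (2 ^ i) n ≤ (2 ^ i) ^ 6 * (1 + ⌈log₂ n ⌉) ^ i
overhead-polylog i n = begin
  β ^ (5 + loglog n)             ≡⟨ ^-distribˡ-+-* β 5 (loglog n) ⟩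
  β ^ 5 * β ^ loglog n           ≡⟨ cong (β ^ 5 *_) (swap i (loglog n)) ⟩
  β ^ 5 * (2 ^ loglog n) ^ i     ≤⟨ *-monoʳ-≤ (β ^ 5) (^-monoˡ-≤ i (2^⌈log₂n⌉≤2[1+n] ⌈log₂ n ⌉)) ⟩
  β ^ 5 * (2 * L) ^ i            ≡⟨ cong (β ^ 5 *_) (^-distribʳ-* i 2 L) ⟩
  β ^ 5 * (β * L ^ i)            ≡⟨ sym (*-assoc (β ^ 5) β (L ^ i)) ⟩
  β ^ 5 * β * L ^ i              ≡⟨ cong (_* L ^ i) (*-comm (β ^ 5) β) ⟩
  β ^ 6 * L ^ i                  ∎
  where
  open ≤-Reasoning
  β = 2 ^ i
  L = 1 + ⌈log₂ n ⌉
  swap : ∀ i l → (2 ^ i) ^ l ≡ (2 ^ l) ^ i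
  swap i l = trans (^-*-assoc 2 i l) (trans (cong (2 ^_) (*-comm i l)) (sym (^-*-assoc 2 l i)))

-- The lower bounds for both compositions.

*-cancel-/ : ∀ {a r w} .{{_ : ℕ.NonZero w}} → a ≤ r / w → a * w ≤ r
*-cancel-/ {a} {r} {w} a≤ = ≤-trans (*-monoˡ-≤ w a≤) (ℕ.m/n*n≤m r w)

deg-exact : ∀ {n} {f : BoolFn n} → Extensional f → HasDeg n (χ ∘ f)
deg-exact {n} {f} f-ext = deg-cong (multilinear-χ (cong χ ∘ f-ext))
  (deg-weaken (≤-reflexive (*-identityʳ n)) (deg-multilinear (χ ∘ f) deg-var))

-- Exact polynomials for `g` feed bits to the approximant of `f`, so the error is unchanged and the
-- degree grows by the arity of `g`.
approx-⊚-exact : ∀ {n m k} {f : BoolFn n} {g : BoolFn m} → Extensional g → ApproxDegAtMost f k → ApproxDegAtMost (f ⊚ g) (k * m)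
approx-⊚-exact {f = f} {g} g-ext (p , d , near)
  with deg-subst (λ i x → g (x ∘ combine i)) (λ i → deg-reindex (combine i) (deg-exact g-ext)) (p , d , λ _ → refl)
... | q , dq , v = q , dq , λ x → subst (λ a → ℚ.∣ a ℚ.- χ (f (λ i → g (x ∘ combine i))) ∣ ℚ.≤ ℤ.+ 1 ℚ./ 3) (sym (v x)) (near (λ i → g (x ∘ combine i)))

approx-weaken : ∀ {n D E} {f : BoolFn n} → D ≤ E → ApproxDegAtMost f D → ApproxDegAtMost f E
approx-weaken D≤E (p , d , near) = p , All.map (λ s → ≤-trans s D≤E) d , near

module _ (b : Base) {β : ℕ} (4*boost-deg≤β : 4 * boost-deg ≤ β) where

  arity≤β : arity b ≤ β
  arity≤β = ≤-trans (arity≤4 b) (≤-trans (m≤m*n 4 boost-deg {{boost-deg≢0}}) 4*boost-deg≤β)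

  β≢0 : ℕ.NonZero β
  β≢0 = ℕ.>-nonZero (≤-trans {j = 4 * boost-deg} (≤-trans (ℕ.>-nonZero⁻¹ boost-deg {{boost-deg≢0}}) (m≤n*m boost-deg 4)) 4*boost-deg≤β)

  approx-growth : ∀ j {d k} → ApproxDegAtMost (fn b ^^ d) k → ApproxDegAtMost (fn b ^^ (j + d)) (β ^ j * k)
  approx-growth zero    {d} {k} A = subst (ApproxDegAtMost (fn b ^^ d)) (sym (*-identityˡ k)) A
  approx-growth (suc j) {d} {k} A = approx-weaken {f = fn b ^^ (suc j + d)}
    (scaled {arity b} boost-deg (β ^ j) k (≤-trans (*-monoˡ-≤ boost-deg (arity≤4 b)) 4*boost-deg≤β))
    (approx-upper b {G = fn b ^^ (j + d)} (approx-growth j {d} A))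
    where
    scaled : ∀ {a β} c x k → a * c ≤ β → a * (c * (x * k)) ≤ β * x * k
    scaled {a} {β} c x k ac≤β = begin
      a * (c * (x * k))  ≡⟨ sym (*-assoc a c (x * k)) ⟩
      a * c * (x * k)    ≤⟨ *-monoˡ-≤ (x * k) ac≤β ⟩
      β * (x * k)        ≡⟨ sym (*-assoc β x k) ⟩
      β * x * k          ∎
      where open ≤-Reasoning

  approx-^^ : ∀ d → ApproxDegAtMost (fn b ^^ d) (arity b ^ d)
  approx-^^ d = approx {f = fn b ^^ d} (deg-exact (^^-ext b d)) (λ x → close (χ-unit ((fn b ^^ d) x)) (ℚ.≤-trans (ℚ.≤-reflexive (err-χ (( fn b ^^ d) x))) (ℚ.≤ᵇ⇒≤ _)))

  -- The shallow case: the arity of h^d, which bounds `e`, is itself within the overhead.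
  trivial : ∀ n d {a e r} → d < 5 + loglog n → a ≤ r → e ≤ arity b ^ d → a * e ≤ boost-deg * r * overhead β n
  trivial n d {a} {e} {r} d< a≤r e≤ = *-mono-≤ (≤-trans a≤r (m≤n*m r boost-deg {{boost-deg≢0}})) (≤-trans e≤
    (≤-trans (^-monoˡ-≤ d (arity≤β)) (^-monoʳ-≤ β {{β≢0}} (<⇒≤ d<))))

  -- The top `5 + loglog n` levels of h^d are spent on amplification. By `approx-growth` the
  -- remaining h^d₂ still has large approximate degree, hence a dual witness, which these levels
  -- make accurate enough for `compose-lower`.
  inner : ∀ n (f : BoolFn n) d a e r → IsApproxDeg f a → IsApproxDeg (fn b ^^ d) e → IsApproxDeg (f ⊚ (fn b ^^ d)) r →
    a * e ≤ boost-deg * r * overhead β n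
  inner n f d a e r (Af , a-min) (Ah , e-min) (Ar , _) with 5 + loglog n ≤? d
  ... | no d< = trivial n d (≰⇒> d<) (a-min r (approx-≼ (⊚-^^-≼ b d (approx-ext {f = f} Af)) Ar)) (e-min _ (approx-^^ d))
  ... | yes d₁≤d with m≤n⇒∃[o]m+o≡n d₁≤d
  inner n f _ a zero r _ _ _ | yes _ | d₂ , refl = ≤-trans (≤-reflexive (*-zeroʳ a)) z≤n
  inner n f _ a (suc e) r (Af , a-min) (Ah , e-min) (Ar , _) | yes _ | d₂ , refl =
    split (approx⊎dual (fn b ^^ d₂) (e / overhead β n) (^^-ext b d₂))
    where
    instance
      overhead≢0 : ℕ.NonZero (overhead β n)
      overhead≢0 = m^n≢0 β (5 + loglog n) {{β≢0}}
    -- `e / overhead β n` is the largest degree that growth by the factor `overhead β n` keeps below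
    -- `suc e`.
    w : ℕ
    w = suc (e / overhead β n)
    split : ApproxDegAtMost (fn b ^^ d₂) (e / overhead β n) ⊎ Dual (fn b ^^ d₂) w (orbit 0) → a * suc e ≤ boost-deg * r * overhead β n
    split (inj₁ A) = contradiction (≤-trans (e-min _ (approx-growth (5 + loglog n) {d₂} A))
      (≤-trans (≤-reflexive (*-comm (overhead β n) (e / overhead β n))) (ℕ.m/n*n≤m e (overhead β n)))) 1+n≰n
    split (inj₂ D) = begin
      a * suc e                     ≤⟨ *-monoʳ-≤ a e<w*B ⟩
      a * (w * overhead β n)          ≡⟨ sym (*-assoc a w (overhead β n)) ⟩
      a * w * overhead β n            ≤⟨ *-monoˡ-≤ (overhead β n) (*-cancel-/ {r = boost-deg * r} (a-min _
        (compose-lower {f = f} {fn b ^^ (5 + loglog n + d₂)} (approx-ext {f = f} Af) (^^-ext b (5 + loglog n + d₂)) (dual-^^ b (5 + loglog n) D)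
          (union-bound (loglog n) (n≤2^2^loglog n)) Ar))) ⟩
      boost-deg * r * overhead β n    ∎
      where
      open ≤-Reasoning
      e<w*B : suc e ≤ w * overhead β n
      e<w*B = subst (_< w * overhead β n) (sym (ℕ.m≡m%n+[m/n]*n e (overhead β n)))
        (+-monoˡ-< (e / overhead β n * overhead β n) (ℕ.m%n<n e (overhead β n)))

  -- Here the witness is for `g`, and the bottom `j` levels of h^d amplify it. `compose-lower`
  -- bounds the degree of the upper part h^d₂, and putting the bottom levels back exactly costs the
  -- factor `arity b ^ j`.
  outer : ∀ m (g : BoolFn m) d e a r → IsApproxDeg (fn b ^^ d) e → IsApproxDeg g a → IsApproxDeg ((fn b ^^ d) ⊚ g) r →
    e * a ≤ boost-deg * r * overhead β (arity b ^ d)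
  outer m g d e a r (Ah , e-min) (Ag , a-min) (Ar , _) with 5 + loglog (arity b ^ d) ≤? d
  ... | no d< = ≤-trans (≤-reflexive (*-comm e a)) (trivial (arity b ^ d) d (≰⇒> d<)
    (a-min r (approx-≼ (^^-⊚-≼ b d (approx-ext {f = g} Ag)) Ar)) (e-min _ (approx-^^ d)))
  outer m g d e zero r _ _ _ | yes _ = ≤-trans (≤-reflexive (*-zeroʳ e)) z≤n
  outer m g d e (suc a) r (Ah , e-min) (Ag , a-min) (Ar , _) | yes d₁≤d =
    split (approx⊎dual g a (approx-ext {f = g} Ag))
    where
    N j d₂ : ℕ
    N  = arity b ^ d
    j  = 5 + loglog N
    d₂ = d ℕ.∸ j
    d₂+j≡d : d₂ + j ≡ d
    d₂+j≡d = m∸n+n≡m d₁≤d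
    Ar′ : ApproxDegAtMost ((fn b ^^ (d₂ + j)) ⊚ g) r
    Ar′ = subst (λ d → ApproxDegAtMost ((fn b ^^ d) ⊚ g) r) (sym d₂+j≡d) Ar
    -- The union bound runs over the inputs of the upper part, of which there are at most `N`.
    N₂≤ : arity b ^ d₂ ≤ 2 ^ (2 ^ loglog N)
    N₂≤ = ≤-trans (^-monoʳ-≤ (arity b) {{arity≢0 b}} (m∸n≤m d j)) (n≤2^2^loglog N)
      where
      arity≢0 : ∀ b → ℕ.NonZero (arity b)
      arity≢0 maj₃  = _
      arity≢0 andOr = _
    split : ApproxDegAtMost g a ⊎ Dual g (suc a) (orbit 0) → e * suc a ≤ boost-deg * r * overhead β N
    split (inj₁ A) = contradiction (a-min a A) 1+n≰n
    split (inj₂ D) = begin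
      e * suc a                                      ≤⟨ *-monoˡ-≤ (suc a) (e-min _ e-upper) ⟩
      boost-deg * r / suc a * arity b ^ j * suc a    ≡⟨ swap (boost-deg * r / suc a) (arity b ^ j) (suc a) ⟩
      boost-deg * r / suc a * suc a * arity b ^ j    ≤⟨ *-mono-≤ (ℕ.m/n*n≤m (boost-deg * r) (suc a)) (^-monoˡ-≤ j arity≤β) ⟩
      boost-deg * r * overhead β N                     ∎
      where
      open ≤-Reasoning
      swap : ∀ x y z → x * y * z ≡ x * z * y
      swap = solve-∀
      e-upper : ApproxDegAtMost (fn b ^^ d) (boost-deg * r / suc a * arity b ^ j)
      e-upper = subst (λ d → ApproxDegAtMost (fn b ^^ d) (boost-deg * r / suc a * arity b ^ j)) d₂+j≡d
        (approx-≼ (^^-+ b d₂ j) (approx-⊚-exact {f = fn b ^^ d₂} {fn b ^^ j} (^^-ext b j)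
          (compose-lower {f = fn b ^^ d₂} {tower b j g} (^^-ext b d₂) (tower-ext b j (approx-ext {f = g} Ag)) (dual-tower b j (approx-ext {f = g} Ag) D)
            (union-bound (loglog N) N₂≤) (approx-≼ (^^-+-⊚ b d₂ j (approx-ext {f = g} Ag)) Ar′))))

-- Taking a power of two for `β` makes the overhead polynomial in the logarithm, with `K` and `k`
-- independent of `n` and `r`.
constants : ∀ i x → 4 * x ≤ 2 ^ i →
  ∃[ β ] ∃[ K ] ∃[ k ] (4 * x ≤ β × ∀ n r → x * r * overhead β n ≤ K * (1 + ⌈log₂ n ⌉) ^ k * r)
constants i x 4x≤ = 2 ^ i , x * (2 ^ i) ^ 6 , i , 4x≤ , λ n r →
  ≤-trans (*-monoʳ-≤ (x * r) (overhead-polylog i n)) (≤-reflexive (swap x r ((2 ^ i) ^ 6) ((1 + ⌈log₂ n ⌉) ^ i)))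
  where
  swap : ∀ x r y z → x * r * (y * z) ≡ x * y * z * r
  swap = solve-∀

theorem2 : (b : Base) →
    ∃[ C ] ∃[ K ] ∃[ k ]
    ((∀ (n : ℕ) (f : BoolFn n) (d : ℕ) → C * ⌈log₂ ⌈log₂ n ⌉ ⌉ ≤ d →
    ∀ (a e r : ℕ) → IsApproxDeg f a → IsApproxDeg (fn b ^^ d) e →
    IsApproxDeg (f ⊚ (fn b ^^ d)) r →
    a * e ≤ K * (1 + ⌈log₂ n ⌉) ^ k * r)
    ×
    (∀ (m : ℕ) (g : BoolFn m) (d : ℕ) → C * ⌈log₂ ⌈log₂ (arity b ^ d) ⌉ ⌉ ≤ d →
    ∀ (e a r : ℕ) → IsApproxDeg (fn b ^^ d) e → IsApproxDeg g a →
    IsApproxDeg ((fn b ^^ d) ⊚ g) r →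
    e * a ≤ K * (1 + ⌈log₂ (arity b ^ d) ⌉) ^ k * r))
theorem2 b with constants boost-exp boost-deg 4*boost-deg≤2^boost-exp
-- The witness 0 for `C` comes from `trivial`, which covers all depths below the amplification
-- threshold.
... | β , K , k , 4*boost-deg≤β , polylog = 0 , K , k ,
  (λ n f d _ a e r Df Dh Dr → ≤-trans (inner b 4*boost-deg≤β n f d a e r Df Dh Dr) (polylog n r)) ,
  (λ m g d _ e a r Dh Dg Dr → ≤-trans (outer b 4*boost-deg≤β m g d e a r Dh Dg Dr) (polylog (arity b ^ d) r))
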